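{- If $(\Sigma_\rho, \Sigma_P) \vdash \langle\!\langle \rho, P \rangle\!\rangle$ and $\langle\!\langle \rho, P \rangle\!\rangle \longrightarrow \Delta$, then $(\Sigma_\rho, \Sigma_P) \vdash \Delta$.
   Context: lqCCS is a quantum process calculus (processes built from discard $\mathbf{0}_{\tilde e}$, $\tau.P$, superoperator application $\mathcal{E}(\tilde e).P$, measurement $M(\tilde e \triangleright x).P$, input $c?x.P$, asynchronous output $c!e$, sum, parallel composition, restriction, if-then-else) with a linear type system with judgments $\Sigma \vdash P$ ensuring each qubit name is sent or discarded exactly once; typing is unique and $\Sigma_P$ denotes the unique set with $\Sigma_P \vdash P$. A configuration $\langle\!\langle \rho, P \rangle\!\rangle$ pairs a density operator $\rho$ over a set of qubits $\Sigma_\rho$ with a closed process $P$, and $(\Sigma_\rho, \Sigma_P) \vdash \langle\!\langle \rho, P \rangle\!\rangle$ holds when $\Sigma_P \subseteq \Sigma_\rho$; the deadlock configuration $\bot$ is typed by every pair, and a distribution $\Delta$ of configurations is typed by $(\Sigma,\Sigma')$ if every configuration in its support is. The relation $\longrightarrow$ is the probabilistic reduction semantics from configurations to distributions: $\tau$-steps, superoperator application $\langle\!\langle \rho, \mathcal{E}(\tilde q).P + Q \rangle\!\rangle \longrightarrow \overline{\langle\!\langle \mathcal{E}_{\tilde q}(\rho), P \rangle\!\rangle}$, measurement yielding $\sum_m p_m \cdot \overline{\langle\!\langle \rho_m/p_m, P[m/y] \rangle\!\rangle}$ with $\rho_m = (M_m)_{\tilde q}(\rho)$, $p_m = \mathrm{tr}(\rho_m)$,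 communication $\langle\!\langle \rho, (c!v + R) \parallel (c?x.P + Q) \rangle\!\rangle \longrightarrow \overline{\langle\!\langle \rho, P[v/x] \rangle\!\rangle}$, plus closure under parallel composition, restriction and structural congruence; here $P[v/x]$ denotes substitution of $v$ for $x$, and a configuration with no move reduces to $\overline{\bot}$. -}

module Defs where

open import Data.Bool.Base using (Bool; true; false; not; _∨_; if_then_else_)
import Data.Bool.Properties as Boolₚ
open import Data.Empty using (⊥)
open import Data.Fin.Base as Fin using (Fin; zero; suc; toℕ)
import Data.Fin.Properties as Finₚ
open import Data.List.Base as List using (List; []; _∷_)
open import Data.List.Membership.Propositional using (_∈_)
open import Data.List.Relation.Binary.Pointwise.Base using (Pointwise)
open import Data.List.Relation.Unary.All as All using (All)
open import Data.List.Relation.Unary.Unique.Propositional using (Unique)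
open import Data.Nat.Base as ℕ using (ℕ)
import Data.Nat.Properties as ℕₚ
open import Data.Product.Base using (∃-syntax; _×_; _,_; proj₁; map₂)
open import Data.Rational.Base as Rat using (ℚ; 0ℚ; 1ℚ; ½)
import Data.Rational.Properties as ℚₚ
open import Data.Rational.Solver using (module +-*-Solver)
open import Data.Sum.Base using (_⊎_)
open import Data.Unit.Base using (⊤)
open import Data.Vec.Base as Vec using (Vec; []; _∷_)
import Data.Vec.Functional as Vector
import Data.Vec.Membership.DecPropositional as DecMembership
import Data.Vec.Properties as Vecₚ
open import Data.Vec.Relation.Unary.All as VecAll using () renaming (All to Allᵥ)
open import Data.Vec.Relation.Unary.Unique.Propositional using () renaming (Unique to Uniqueᵥ)
open import Level using (0ℓ)
open import Relation.Binary.Definitions using (DecidableEquality)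
open import Relation.Binary.PropositionalEquality.Core using (_≡_; _≢_; refl; sym; cong; subst)
open import Relation.Nullary.Decidable.Core using (Dec; yes; no; does; _⊎-dec_)
open import Relation.Nullary.Negation.Core using (¬_)
open import Relation.Unary using (Pred; _≐_; _∪_; _⊆_; ｛_｝; ∅) renaming (_⊥_ to _disjoint_)

-- Real numbers: Cauchy sequences of rationals, with _≈ᵣ_ as equality.

Cauchy : (ℕ → ℚ) → Set
Cauchy x = ∀ ε → 0ℚ Rat.< ε → ∃[ N ] ∀ m n → N ℕ.≤ m → N ℕ.≤ n → Rat.∣ x m Rat.- x n ∣ Rat.< ε

record ℝ : Set where
  no-eta-equality
  pattern
  constructor real
  field
    seq    : ℕ → ℚ
    cauchy : Cauchy seq

module CauchyClosure where
  open Rat using (_+_; _*_; -_; _-_; _<_; ∣_∣; 1/_; NonZero; Positive; positive)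
  open ℚₚ.≤-Reasoning
  open +-*-Solver using (solve; _:+_; _:*_; :-_; _:-_; _:=_; con)

  abstract
    half-pos : ∀ {ε} → 0ℚ < ε → 0ℚ < ½ * ε
    half-pos {ε} 0<ε = ℚₚ.positive⁻¹ (½ * ε) {{ℚₚ.pos*pos⇒pos ½ ε {{positive 0<ε}}}}

    halves : ∀ ε → ½ * ε + ½ * ε ≡ ε
    halves = solve 1 (λ e → con ½ :* e :+ con ½ :* e := e) refl

    +-regroup : ∀ a b c d → (a + b) - (c + d) ≡ (a - c) + (b - d)
    +-regroup = solve 4 (λ a b c d → (a :+ b) :- (c :+ d) := (a :- c) :+ (b :- d)) refl

    *-regroup : ∀ a b c d → a * b - c * d ≡ a * (b - d) + d * (a - c)
    *-regroup = solve 4 (λ a b c d → a :* b :- c :* d := a :* (b :- d) :+ d :* (a :- c)) refl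

    neg-regroup : ∀ a b → (- a) - (- b) ≡ - (a - b)
    neg-regroup = solve 2 (λ a b → (:- a) :- (:- b) := :- (a :- b)) refl

    sub-add : ∀ a b → a ≡ (a - b) + b
    sub-add = solve 2 (λ a b → a := (a :- b) :+ b) refl

    bounded : ∀ {x} → Cauchy x → ∃[ B ] ∃[ N ] 0ℚ < B × (∀ n → N ℕ.≤ n → ∣ x n ∣ < B)
    bounded {x} cx = let N , close = cx 1ℚ (ℚₚ.positive⁻¹ 1ℚ) in
      1ℚ + ∣ x N ∣ , N , ℚₚ.+-mono-<-≤ (ℚₚ.positive⁻¹ 1ℚ) (ℚₚ.0≤∣p∣ (x N)) , λ n N≤n → begin-strict
      ∣ x n ∣                    ≡⟨ cong ∣_∣ (sub-add (x n) (x N)) ⟩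
      ∣ (x n - x N) + x N ∣      ≤⟨ ℚₚ.∣p+q∣≤∣p∣+∣q∣ (x n - x N) (x N) ⟩
      ∣ x n - x N ∣ + ∣ x N ∣    <⟨ ℚₚ.+-monoˡ-< ∣ x N ∣ (close n N N≤n ℕₚ.≤-refl) ⟩
      1ℚ + ∣ x N ∣               ∎

    shrink : ∀ {B ε} → 0ℚ < B → 0ℚ < ε →
             ∃[ δ ] 0ℚ < δ × (∀ p q → ∣ p ∣ < B → ∣ q ∣ < δ → ∣ p * q ∣ < ε)
    shrink {B} {ε} 0<B 0<ε = δ , ℚₚ.positive⁻¹ δ , λ p q p<B q<δ → begin-strict
      ∣ p * q ∣          ≡⟨ ℚₚ.∣p*q∣≡∣p∣*∣q∣ p q ⟩
      ∣ p ∣ * ∣ q ∣      ≤⟨ ℚₚ.*-monoʳ-≤-nonNeg ∣ q ∣ {{ℚₚ.∣-∣-nonNeg q}} (ℚₚ.<⇒≤ p<B) ⟩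
      B * ∣ q ∣          <⟨ ℚₚ.*-monoʳ-<-pos B q<δ ⟩
      B * (1/ B * ε)     ≡⟨ ℚₚ.*-assoc B (1/ B) ε ⟨
      (B * 1/ B) * ε     ≡⟨ cong (_* ε) (ℚₚ.*-inverseʳ B) ⟩
      1ℚ * ε             ≡⟨ ℚₚ.*-identityˡ ε ⟩
      ε                  ∎
      where
      instance
        B⁺ : Positive B
        B⁺ = positive 0<B
        ε⁺ : Positive ε
        ε⁺ = positive 0<ε
        B≠0 : NonZero B
        B≠0 = ℚₚ.pos⇒nonZero B
        B⁻¹⁺ : Positive (1/ B)
        B⁻¹⁺ = ℚₚ.1/pos⇒pos B
      δ : ℚ
      δ = 1/ B * ε
      instance
        δ⁺ : Positive δ
        δ⁺ = ℚₚ.pos*pos⇒pos (1/ B) ε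

    const-cauchy : ∀ q → Cauchy (λ _ → q)
    const-cauchy q ε 0<ε = 0 , λ _ _ _ _ → subst (_< ε) (cong ∣_∣ (sym (ℚₚ.+-inverseʳ q))) 0<ε

    +-cauchy : ∀ {x y} → Cauchy x → Cauchy y → Cauchy (λ n → x n + y n)
    +-cauchy {x} {y} cx cy ε 0<ε =
      let N₁ , h₁ = cx (½ * ε) (half-pos 0<ε)
          N₂ , h₂ = cy (½ * ε) (half-pos 0<ε)
      in N₁ ℕ.⊔ N₂ , λ m n N≤m N≤n → begin-strict
      ∣ (x m + y m) - (x n + y n) ∣      ≡⟨ cong ∣_∣ (+-regroup (x m) (y m) (x n) (y n)) ⟩
      ∣ (x m - x n) + (y m - y n) ∣      ≤⟨ ℚₚ.∣p+q∣≤∣p∣+∣q∣ (x m - x n) (y m - y n) ⟩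
      ∣ x m - x n ∣ + ∣ y m - y n ∣      <⟨ ℚₚ.+-mono-< (h₁ m n (ℕₚ.m⊔n≤o⇒m≤o N₁ N₂ N≤m) (ℕₚ.m⊔n≤o⇒m≤o N₁ N₂ N≤n))
                                                       (h₂ m n (ℕₚ.m⊔n≤o⇒n≤o N₁ N₂ N≤m) (ℕₚ.m⊔n≤o⇒n≤o N₁ N₂ N≤n)) ⟩
      ½ * ε + ½ * ε                      ≡⟨ halves ε ⟩
      ε                                  ∎

    neg-cauchy : ∀ {x} → Cauchy x → Cauchy (λ n → - x n)
    neg-cauchy {x} cx ε 0<ε = let N , h = cx ε 0<ε in N , λ m n N≤m N≤n → begin-strict
      ∣ - x m - - x n ∣    ≡⟨ cong ∣_∣ (neg-regroup (x m) (x n)) ⟩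
      ∣ - (x m - x n) ∣    ≡⟨ ℚₚ.∣-p∣≡∣p∣ (x m - x n) ⟩
      ∣ x m - x n ∣        <⟨ h m n N≤m N≤n ⟩
      ε                    ∎

    *-cauchy : ∀ {x y} → Cauchy x → Cauchy y → Cauchy (λ n → x n * y n)
    *-cauchy {x} {y} cx cy ε 0<ε =
      let A , N₁ , 0<A , x<A = bounded {x} cx
          B , N₂ , 0<B , y<B = bounded {y} cy
          δ , 0<δ , sx = shrink 0<A (half-pos 0<ε)
          η , 0<η , sy = shrink 0<B (half-pos 0<ε)
          N₃ , hy = cy δ 0<δ
          N₄ , hx = cx η 0<η
          ≤₁ = ℕₚ.≤-trans (ℕₚ.m≤m⊔n N₁ N₂) (ℕₚ.m≤m⊔n _ (N₃ ℕ.⊔ N₄))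
          ≤₂ = ℕₚ.≤-trans (ℕₚ.m≤n⊔m N₁ N₂) (ℕₚ.m≤m⊔n _ (N₃ ℕ.⊔ N₄))
          ≤₃ = ℕₚ.≤-trans (ℕₚ.m≤m⊔n N₃ N₄) (ℕₚ.m≤n⊔m (N₁ ℕ.⊔ N₂) _)
          ≤₄ = ℕₚ.≤-trans (ℕₚ.m≤n⊔m N₃ N₄) (ℕₚ.m≤n⊔m (N₁ ℕ.⊔ N₂) _)
      in (N₁ ℕ.⊔ N₂) ℕ.⊔ (N₃ ℕ.⊔ N₄) , λ m n N≤m N≤n → begin-strict
      ∣ x m * y m - x n * y n ∣                      ≡⟨ cong ∣_∣ (*-regroup (x m) (y m) (x n) (y n)) ⟩
      ∣ x m * (y m - y n) + y n * (x m - x n) ∣      ≤⟨ ℚₚ.∣p+q∣≤∣p∣+∣q∣ (x m * (y m - y n)) (y n * (x m - x n)) ⟩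
      ∣ x m * (y m - y n) ∣ + ∣ y n * (x m - x n) ∣  <⟨ ℚₚ.+-mono-<
          (sx (x m) (y m - y n) (x<A m (ℕₚ.≤-trans ≤₁ N≤m)) (hy m n (ℕₚ.≤-trans ≤₃ N≤m) (ℕₚ.≤-trans ≤₃ N≤n)))
          (sy (y n) (x m - x n) (y<B n (ℕₚ.≤-trans ≤₂ N≤n)) (hx m n (ℕₚ.≤-trans ≤₄ N≤m) (ℕₚ.≤-trans ≤₄ N≤n))) ⟩
      ½ * ε + ½ * ε                                  ≡⟨ halves ε ⟩
      ε                                              ∎

infix  4 _≈ᵣ_ _≤ᵣ_
infixl 6 _+ᵣ_
infixl 7 _*ᵣ_
infix  8 -ᵣ_

record _≈ᵣ_ (x y : ℝ) : Set where
  constructor mk≈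
  field
    close : ∀ ε → 0ℚ Rat.< ε → ∃[ N ] ∀ n → N ℕ.≤ n → Rat.∣ ℝ.seq x n Rat.- ℝ.seq y n ∣ Rat.< ε

record _≤ᵣ_ (x y : ℝ) : Set where
  constructor mk≤
  field
    below : ∀ ε → 0ℚ Rat.< ε → ∃[ N ] ∀ n → N ℕ.≤ n → ℝ.seq x n Rat.< ℝ.seq y n Rat.+ ε

fromℚ : ℚ → ℝ
fromℚ q = real (λ _ → q) (CauchyClosure.const-cauchy q)

0ᵣ 1ᵣ : ℝ
0ᵣ = fromℚ 0ℚ
1ᵣ = fromℚ 1ℚ

_+ᵣ_ _*ᵣ_ : ℝ → ℝ → ℝ
real x cx +ᵣ real y cy = real (λ n → x n Rat.+ y n) (CauchyClosure.+-cauchy {x} {y} cx cy)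
real x cx *ᵣ real y cy = real (λ n → x n Rat.* y n) (CauchyClosure.*-cauchy {x} {y} cx cy)

-ᵣ_ : ℝ → ℝ
-ᵣ real x cx = real (λ n → Rat.- x n) (CauchyClosure.neg-cauchy {x} cx)

infix  4 _≈ᶜ_
infixl 6 _+ᶜ_
infixl 7 _*ᶜ_

record ℂ : Set where
  no-eta-equality
  pattern
  constructor _+i_
  field
    re im : ℝ
open ℂ public

_≈ᶜ_ : ℂ → ℂ → Set
z ≈ᶜ w = re z ≈ᵣ re w × im z ≈ᵣ im w

0ᶜ 1ᶜ : ℂ
0ᶜ = 0ᵣ +i 0ᵣ
1ᶜ = 1ᵣ +i 0ᵣ

_+ᶜ_ _*ᶜ_ : ℂ → ℂ → ℂ
(x +i y) +ᶜ (u +i v) = (x +ᵣ u) +i (y +ᵣ v)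
(x +i y) *ᶜ (u +i v) = (x *ᵣ u +ᵣ -ᵣ (y *ᵣ v)) +i (x *ᵣ v +ᵣ y *ᵣ u)

conj : ℂ → ℂ
conj (x +i y) = x +i (-ᵣ y)

Basis : ℕ → Set
Basis n = Vec Bool n

Ket : ℕ → Set
Ket n = Basis n → ℂ

-- Matrices in the computational basis.
Operator : ℕ → Set
Operator n = Basis n → Basis n → ℂ

∑ : ∀ {n} → (Basis n → ℂ) → ℂ
∑ {ℕ.zero}  f = f []
∑ {ℕ.suc n} f = ∑ (λ b → f (false ∷ b)) +ᶜ ∑ (λ b → f (true ∷ b))

infix  4 _≈ₒ_
infixl 7 _∙_
infixr 8 _•_
infix  9 _†

_≈ₒ_ : ∀ {n} → Operator n → Operator n → Set
A ≈ₒ B = ∀ b c → A b c ≈ᶜ B b c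

_∙_ : ∀ {n} → Operator n → Operator n → Operator n
(A ∙ B) b c = ∑ λ d → A b d *ᶜ B d c

_† : ∀ {n} → Operator n → Operator n
(A †) b c = conj (A c b)

_•_ : ∀ {n} → ℝ → Operator n → Operator n
(p • A) b c = (p +i 0ᵣ) *ᶜ A b c

𝟙 : ∀ {n} → Operator n
𝟙 b c = if does (Vecₚ.≡-dec Boolₚ._≟_ b c) then 1ᶜ else 0ᶜ

∑ₒ : ∀ {k n} → (Fin k → Operator n) → Operator n
∑ₒ A b c = Vector.foldr _+ᶜ_ 0ᶜ λ i → A i b c

tr : ∀ {n} → Operator n → ℂ
tr A = ∑ λ b → A b b

⟨_∣_∣_⟩ : ∀ {n} → Ket n → Operator n → Ket n → ℂ
⟨ v ∣ A ∣ w ⟩ = ∑ λ b → ∑ λ c → conj (v b) *ᶜ (A b c *ᶜ w c)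

record IsPositive {n} (A : Operator n) : Set where
  field
    real-valued : ∀ v → im ⟨ v ∣ A ∣ v ⟩ ≈ᵣ 0ᵣ
    nonNegative : ∀ v → 0ᵣ ≤ᵣ re ⟨ v ∣ A ∣ v ⟩

record IsDensity {n} (ρ : Operator n) : Set where
  field
    positive   : IsPositive ρ
    unit-trace : tr ρ ≈ᶜ 1ᶜ

record KrausFamily (n : ℕ) : Set where
  field
    {size}   : ℕ
    kraus    : Fin size → Operator n
    complete : ∑ₒ (λ i → kraus i † ∙ kraus i) ≈ₒ 𝟙
open KrausFamily public

-- A trace-preserving superoperator is given by a Kraus decomposition
-- ρ ↦ ∑ᵢ Kᵢ ρ Kᵢ†, a measurement by one operator for each outcome 0, …, size - 1.
Superoperator Measurement : ℕ → Set
Superoperator = KrausFamily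
Measurement   = KrausFamily

agreeOff? : ∀ {k n} (pos : Vec (Fin n) k) (b c : Basis n) →
            Dec (∀ i → DecMembership._∈_ Finₚ._≟_ i pos ⊎ Vec.lookup b i ≡ Vec.lookup c i)
agreeOff? pos b c = Finₚ.all? λ i →
  DecMembership._∈?_ Finₚ._≟_ i pos ⊎-dec (Vec.lookup b i Boolₚ.≟ Vec.lookup c i)

-- K acting on the qubits at the (distinct) positions pos, tensored with the
-- identity on all the others.
_at_ : ∀ {k n} → Operator k → Vec (Fin n) k → Operator n
(K at pos) b c =
  if does (agreeOff? pos b c)
  then K (Vec.map (Vec.lookup b) pos) (Vec.map (Vec.lookup c) pos)
  else 0ᶜ

conjugate : ∀ {k n} → Operator k → Vec (Fin n) k → Operator n → Operator n
conjugate K pos ρ = (K at pos) ∙ ρ ∙ (K at pos) †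

applyAt : ∀ {k n} → Superoperator k → Vec (Fin n) k → Operator n → Operator n
applyAt ℰ pos ρ = ∑ₒ λ i → conjugate (kraus ℰ i) pos ρ

-- Bound variables are de Bruijn indices; Proc n has n of them free.

Qubit : Set
Qubit = ℕ

data Ty : Set where
  bool nat qubit : Ty

_≟ᵗ_ : DecidableEquality Ty
bool  ≟ᵗ bool  = yes refl
bool  ≟ᵗ nat   = no λ ()
bool  ≟ᵗ qubit = no λ ()
nat   ≟ᵗ bool  = no λ ()
nat   ≟ᵗ nat   = yes refl
nat   ≟ᵗ qubit = no λ ()
qubit ≟ᵗ bool  = no λ ()
qubit ≟ᵗ nat   = no λ ()
qubit ≟ᵗ qubit = yes refl

record Chan : Set where
  constructor chan
  field
    carries : Ty
    label   : ℕ
open Chan public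

data Value : Set where
  bool  : Bool → Value
  nat   : ℕ → Value
  qubit : Qubit → Value

typeOf : Value → Ty
typeOf (bool _)  = bool
typeOf (nat _)   = nat
typeOf (qubit _) = qubit

data Expr (n : ℕ) : Set where
  var       : Fin n → Expr n
  val       : Value → Expr n
  ¬ₑ_       : Expr n → Expr n
  _∨ₑ_ _≤ₑ_ : Expr n → Expr n → Expr n

infixl 5 _⊕_
infixl 4 _∥_
infixl 6 _╲_
infixr 7 τ∙_ _！_ _？_

data Proc (n : ℕ) : Set where
  discard : List (Expr n) → Proc n
  τ∙_     : Proc n → Proc n
  apply   : ∀ {k} → Superoperator k → Vec (Expr n) k → Proc n → Proc n
  measure : ∀ {k} → Measurement k → Vec (Expr n) k → Proc (ℕ.suc n) → Proc n
  _？_    : Chan → Proc (ℕ.suc n) → Proc n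
  _！_    : Chan → Expr n → Proc n
  _⊕_     : Proc n → Proc n → Proc n
  _∥_     : Proc n → Proc n → Proc n
  _╲_     : Proc n → Chan → Proc n
  ite     : Expr n → Proc n → Proc n → Proc n

weaken : ∀ {n} → Expr n → Expr (ℕ.suc n)
weaken (var x)  = var (suc x)
weaken (val v)  = val v
weaken (¬ₑ e)   = ¬ₑ weaken e
weaken (e ∨ₑ f) = weaken e ∨ₑ weaken f
weaken (e ≤ₑ f) = weaken e ≤ₑ weaken f

lift : ∀ {m n} → (Fin m → Expr n) → Fin (ℕ.suc m) → Expr (ℕ.suc n)
lift σ zero    = var zero
lift σ (suc x) = weaken (σ x)

substₑ : ∀ {m n} → (Fin m → Expr n) → Expr m → Expr n
substₑ σ (var x)  = σ x
substₑ σ (val v)  = val v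
substₑ σ (¬ₑ e)   = ¬ₑ substₑ σ e
substₑ σ (e ∨ₑ f) = substₑ σ e ∨ₑ substₑ σ f
substₑ σ (e ≤ₑ f) = substₑ σ e ≤ₑ substₑ σ f

substₚ : ∀ {m n} → (Fin m → Expr n) → Proc m → Proc n
substₚ σ (discard es)     = discard (List.map (substₑ σ) es)
substₚ σ (τ∙ P)           = τ∙ substₚ σ P
substₚ σ (apply ℰ es P)   = apply ℰ (Vec.map (substₑ σ) es) (substₚ σ P)
substₚ σ (measure M es P) = measure M (Vec.map (substₑ σ) es) (substₚ (lift σ) P)
substₚ σ (c ？ P)         = c ？ substₚ (lift σ) P
substₚ σ (c ！ e)         = c ！ substₑ σ e
substₚ σ (P ⊕ Q)          = substₚ σ P ⊕ substₚ σ Q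
substₚ σ (P ∥ Q)          = substₚ σ P ∥ substₚ σ Q
substₚ σ (P ╲ c)          = substₚ σ P ╲ c
substₚ σ (ite e P Q)      = ite (substₑ σ e) (substₚ σ P) (substₚ σ Q)

_[_] : ∀ {n} → Proc (ℕ.suc n) → Value → Proc n
P [ v ] = substₚ σ P
  where
  σ : ∀ {n} → Fin (ℕ.suc n) → Expr n
  σ zero    = val v
  σ (suc x) = var x

_∈fc_ : ∀ {n} → Chan → Proc n → Set
c ∈fc discard _     = ⊥
c ∈fc (τ∙ P)        = c ∈fc P
c ∈fc apply _ _ P   = c ∈fc P
c ∈fc measure _ _ P = c ∈fc P
c ∈fc (d ？ P)      = c ≡ d ⊎ c ∈fc P
c ∈fc (d ！ _)      = c ≡ d
c ∈fc (P ⊕ Q)       = c ∈fc P ⊎ c ∈fc Q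
c ∈fc (P ∥ Q)       = c ∈fc P ⊎ c ∈fc Q
c ∈fc (P ╲ d)       = c ≢ d × c ∈fc P
c ∈fc ite _ P Q     = c ∈fc P ⊎ c ∈fc Q

swapLabel : ℕ → ℕ → ℕ → ℕ
swapLabel i j k = if does (k ℕₚ.≟ i) then j else if does (k ℕₚ.≟ j) then i else k

-- Transposition of the channels chan T i and chan T j, at free, bound and
-- binding occurrences alike.
module Swap (T : Ty) (i j : ℕ) where

  swapᶜ : Chan → Chan
  swapᶜ (chan U k) = chan U (if does (U ≟ᵗ T) then swapLabel i j k else k)

  swap : ∀ {n} → Proc n → Proc n
  swap (discard es)     = discard es
  swap (τ∙ P)           = τ∙ swap P
  swap (apply ℰ es P)   = apply ℰ es (swap P)
  swap (measure M es P) = measure M es (swap P)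
  swap (c ？ P)         = swapᶜ c ？ swap P
  swap (c ！ e)         = swapᶜ c ！ e
  swap (P ⊕ Q)          = swap P ⊕ swap Q
  swap (P ∥ Q)          = swap P ∥ swap Q
  swap (P ╲ c)          = swap P ╲ swapᶜ c
  swap (ite e P Q)      = ite e (swap P) (swap Q)

Ctx : ℕ → Set
Ctx n = Vec Ty n

infix 3 _⊢_∶_ _⨾_⊢_

data _⊢_∶_ {n} (Γ : Ctx n) : Expr n → Ty → Set where
  var : ∀ x → Γ ⊢ var x ∶ Vec.lookup Γ x
  val : ∀ v → Γ ⊢ val v ∶ typeOf v
  ¬ₑ_ : ∀ {e} → Γ ⊢ e ∶ bool → Γ ⊢ ¬ₑ e ∶ bool
  _∨ₑ_ : ∀ {e f} → Γ ⊢ e ∶ bool → Γ ⊢ f ∶ bool → Γ ⊢ e ∨ₑ f ∶ bool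
  _≤ₑ_ : ∀ {e f} → Γ ⊢ e ∶ nat → Γ ⊢ f ∶ nat → Γ ⊢ e ≤ₑ f ∶ bool

-- What a linear set Σ may contain: qubits and variables standing for qubits.
data Name (n : ℕ) : Set where
  qubit : Qubit → Name n
  var   : Fin n → Name n

⌜_⌝ : ∀ {n} → Name n → Expr n
⌜ qubit q ⌝ = val (qubit q)
⌜ var x ⌝   = var x

NameSet : ℕ → Set₁
NameSet n = Pred (Name n) 0ℓ

-- The same set under one more binder, not containing the new variable.
↑_ : ∀ {n} → NameSet n → NameSet (ℕ.suc n)
(↑ Σ) (qubit q)     = Σ (qubit q)
(↑ Σ) (var zero)    = ⊥
(↑ Σ) (var (suc x)) = Σ (var x)

-- Sets are predicates up to _≐_; a derivable Σ is necessarily finite.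
data _⨾_⊢_ {n} (Γ : Ctx n) (Σ : NameSet n) : Proc n → Set₁ where

  discard : ∀ (as : List (Name n)) →
            All (λ a → Γ ⊢ ⌜ a ⌝ ∶ qubit) as → Unique as → Σ ≐ (_∈ as) →
            ∀ {es} → es ≡ List.map ⌜_⌝ as →
            Γ ⨾ Σ ⊢ discard es

  τ∙_ : ∀ {P} → Γ ⨾ Σ ⊢ P → Γ ⨾ Σ ⊢ τ∙ P

  apply : ∀ {k} {ℰ : Superoperator k} {P} (as : Vec (Name n) k) →
          Uniqueᵥ as → Allᵥ Σ as →
          ∀ {es} → es ≡ Vec.map ⌜_⌝ as →
          Γ ⨾ Σ ⊢ P →
          Γ ⨾ Σ ⊢ apply ℰ es P

  measure : ∀ {k} {M : Measurement k} {P} (as : Vec (Name n) k) →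
            Uniqueᵥ as → Allᵥ Σ as →
            ∀ {es} → es ≡ Vec.map ⌜_⌝ as →
            nat ∷ Γ ⨾ ↑ Σ ⊢ P →
            Γ ⨾ Σ ⊢ measure M es P

  recvᶜ : ∀ {c P} → carries c ≢ qubit →
          carries c ∷ Γ ⨾ ↑ Σ ⊢ P →
          Γ ⨾ Σ ⊢ c ？ P

  recvᵠ : ∀ {c P} → carries c ≡ qubit →
          qubit ∷ Γ ⨾ (↑ Σ) ∪ ｛ var zero ｝ ⊢ P →
          Γ ⨾ Σ ⊢ c ？ P

  sendᶜ : ∀ {c e} → carries c ≢ qubit →
          Γ ⊢ e ∶ carries c → Σ ≐ ∅ →
          Γ ⨾ Σ ⊢ c ！ e

  sendᵠ : ∀ {c} (a : Name n) → carries c ≡ qubit →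
          Γ ⊢ ⌜ a ⌝ ∶ qubit → Σ ≐ ｛ a ｝ →
          ∀ {e} → e ≡ ⌜ a ⌝ →
          Γ ⨾ Σ ⊢ c ！ e

  _⊕_ : ∀ {P Q} → Γ ⨾ Σ ⊢ P → Γ ⨾ Σ ⊢ Q → Γ ⨾ Σ ⊢ P ⊕ Q

  par : ∀ {P Q} (Σ₁ Σ₂ : NameSet n) → Σ₁ disjoint Σ₂ → Σ ≐ Σ₁ ∪ Σ₂ →
        Γ ⨾ Σ₁ ⊢ P → Γ ⨾ Σ₂ ⊢ Q →
        Γ ⨾ Σ ⊢ P ∥ Q

  res : ∀ {P c} → Γ ⨾ Σ ⊢ P → Γ ⨾ Σ ⊢ P ╲ c

  ite : ∀ {e P Q} → Γ ⊢ e ∶ bool → Γ ⨾ Σ ⊢ P → Γ ⨾ Σ ⊢ Q → Γ ⨾ Σ ⊢ ite e P Q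

infix 3 _⇓_ _⊢_≋_

data _⇓_ {n} : Expr n → Value → Set where
  val  : ∀ v → val v ⇓ v
  ¬ₑ_  : ∀ {e b} → e ⇓ bool b → ¬ₑ e ⇓ bool (not b)
  _∨ₑ_ : ∀ {e f b c} → e ⇓ bool b → f ⇓ bool c → e ∨ₑ f ⇓ bool (b ∨ c)
  _≤ₑ_ : ∀ {e f k l} → e ⇓ nat k → f ⇓ nat l → e ≤ₑ f ⇓ bool (k ℕ.≤ᵇ l)

-- The typing premises of ⊕-nil, ite-true and ite-false restrict these axioms to
-- well-typed processes: in the other axioms one side is typed by Σ whenever the
-- other one is, but these would introduce arbitrary untyped subprocesses.
data _⊢_≋_ {n} (Γ : Ctx n) : Proc n → Proc n → Set₁ where
  ≋-refl  : ∀ {P} → Γ ⊢ P ≋ P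
  ≋-sym   : ∀ {P Q} → Γ ⊢ P ≋ Q → Γ ⊢ Q ≋ P
  ≋-trans : ∀ {P Q R} → Γ ⊢ P ≋ Q → Γ ⊢ Q ≋ R → Γ ⊢ P ≋ R

  τ-cong       : ∀ {P Q} → Γ ⊢ P ≋ Q → Γ ⊢ τ∙ P ≋ τ∙ Q
  apply-cong   : ∀ {k} {ℰ : Superoperator k} {es P Q} →
                 Γ ⊢ P ≋ Q → Γ ⊢ apply ℰ es P ≋ apply ℰ es Q
  measure-cong : ∀ {k} {M : Measurement k} {es P Q} →
                 nat ∷ Γ ⊢ P ≋ Q → Γ ⊢ measure M es P ≋ measure M es Q
  recv-cong    : ∀ {c P Q} → carries c ∷ Γ ⊢ P ≋ Q → Γ ⊢ c ？ P ≋ c ？ Q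
  ⊕-cong       : ∀ {P P′ Q Q′} → Γ ⊢ P ≋ P′ → Γ ⊢ Q ≋ Q′ → Γ ⊢ P ⊕ Q ≋ P′ ⊕ Q′
  ∥-cong       : ∀ {P P′ Q Q′} → Γ ⊢ P ≋ P′ → Γ ⊢ Q ≋ Q′ → Γ ⊢ P ∥ Q ≋ P′ ∥ Q′
  ╲-cong       : ∀ {P Q c} → Γ ⊢ P ≋ Q → Γ ⊢ P ╲ c ≋ Q ╲ c
  ite-cong     : ∀ {e P P′ Q Q′} → Γ ⊢ P ≋ P′ → Γ ⊢ Q ≋ Q′ → Γ ⊢ ite e P Q ≋ ite e P′ Q′

  ⊕-comm  : ∀ {P Q} → Γ ⊢ P ⊕ Q ≋ Q ⊕ P
  ⊕-assoc : ∀ {P Q R} → Γ ⊢ (P ⊕ Q) ⊕ R ≋ P ⊕ (Q ⊕ R)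
  ⊕-nil   : ∀ {Σ P es} → Γ ⨾ Σ ⊢ P → Γ ⨾ Σ ⊢ discard es → Γ ⊢ P ⊕ discard es ≋ P

  ∥-comm  : ∀ {P Q} → Γ ⊢ P ∥ Q ≋ Q ∥ P
  ∥-assoc : ∀ {P Q R} → Γ ⊢ (P ∥ Q) ∥ R ≋ P ∥ (Q ∥ R)
  ∥-nil   : ∀ {P} → Γ ⊢ P ∥ discard [] ≋ P

  ╲-comm  : ∀ {P c d} → Γ ⊢ P ╲ c ╲ d ≋ P ╲ d ╲ c
  ╲-nil   : ∀ {es c} → Γ ⊢ discard es ╲ c ≋ discard es
  ╲-extr  : ∀ {P Q c} → ¬ c ∈fc Q → Γ ⊢ (P ╲ c) ∥ Q ≋ (P ∥ Q) ╲ c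
  ╲-alpha : ∀ {P} T i j → ¬ chan T j ∈fc P →
            Γ ⊢ P ╲ chan T i ≋ Swap.swap T i j P ╲ chan T j

  send-eval : ∀ {c e v} → e ⇓ v → Γ ⊢ c ！ e ≋ c ！ val v
  ite-true  : ∀ {Σ e P Q} → e ⇓ bool true →
              Γ ⨾ Σ ⊢ P → Γ ⨾ Σ ⊢ Q → Γ ⊢ ite e P Q ≋ P
  ite-false : ∀ {Σ e P Q} → e ⇓ bool false →
              Γ ⨾ Σ ⊢ P → Γ ⨾ Σ ⊢ Q → Γ ⊢ ite e P Q ≋ Q

-- An operator on the qubits of the register, in the order in which they are
-- listed. That it is a density operator, and that the register has no
-- repetitions, is part of the typing of configurations.
record State : Set where
  constructor _⊩_
  field
    register : List Qubit
    operator : Operator (List.length register)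
open State public

data Conf : Set where
  ⊥ᶜ    : Conf
  ⟪_,_⟫ : State → Proc 0 → Conf

-- The formal sum ∑ᵢ pᵢ · Cᵢ. That the weights are probabilities summing to 1 is
-- IsDistribution below.
Dist : Set
Dist = List (ℝ × Conf)

dirac : Conf → Dist
dirac C = (1ᵣ , C) ∷ []

mapProc : (Proc 0 → Proc 0) → Dist → Dist
mapProc f = List.map (map₂ mapConf)
  where
  mapConf : Conf → Conf
  mapConf ⊥ᶜ        = ⊥ᶜ
  mapConf ⟪ ρ , P ⟫ = ⟪ ρ , f P ⟫

infix 3 _≋ˢ_ _≋ᶜ_ _≋ᵈ_ _⟶₀_ _⟶_

data _≋ˢ_ : State → State → Set where
  eq : ∀ {qs A B} → A ≈ₒ B → (qs ⊩ A) ≋ˢ (qs ⊩ B)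

data _≋ᶜ_ : Conf → Conf → Set₁ where
  dead : ⊥ᶜ ≋ᶜ ⊥ᶜ
  conf : ∀ {ρ σ P Q} → ρ ≋ˢ σ → [] ⊢ P ≋ Q → ⟪ ρ , P ⟫ ≋ᶜ ⟪ σ , Q ⟫

_≋ᵈ_ : Dist → Dist → Set₁
_≋ᵈ_ = Pointwise λ (p , C) (q , D) → p ≈ᵣ q × C ≋ᶜ D

-- The reduction rules, without the one for deadlocked configurations.
data _⟶₀_ : Conf → Dist → Set₁ where

  tau : ∀ {ρ P Q} → ⟪ ρ , τ∙ P ⊕ Q ⟫ ⟶₀ dirac ⟪ ρ , P ⟫

  apply : ∀ {reg ρ k P Q} {ℰ : Superoperator k} {qs : Vec Qubit k}
          (pos : Vec (Fin (List.length reg)) k) → Vec.map (List.lookup reg) pos ≡ qs →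
          ⟪ reg ⊩ ρ , apply ℰ (Vec.map (λ q → val (qubit q)) qs) P ⊕ Q ⟫
            ⟶₀ dirac ⟪ reg ⊩ applyAt ℰ pos ρ , P ⟫

  -- σ m is ρₘ / pₘ, which is determined up to _≈ₒ_ unless pₘ is zero, and
  -- outcome m is then not in the support.
  measure : ∀ {reg ρ k P Q} {M : Measurement k} {qs : Vec Qubit k}
            (pos : Vec (Fin (List.length reg)) k) → Vec.map (List.lookup reg) pos ≡ qs →
            let ρₘ = λ m → conjugate (kraus M m) pos ρ
                p  = λ m → re (tr (ρₘ m)) in
            (σ : Fin (size M) → Operator (List.length reg)) → (∀ m → p m • σ m ≈ₒ ρₘ m) →
            ⟪ reg ⊩ ρ , measure M (Vec.map (λ q → val (qubit q)) qs) P ⊕ Q ⟫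
              ⟶₀ List.tabulate λ m → p m , ⟪ reg ⊩ σ m , P [ nat (toℕ m) ] ⟫

  comm : ∀ {ρ c v P Q R} →
         ⟪ ρ , (c ！ val v ⊕ R) ∥ (c ？ P ⊕ Q) ⟫ ⟶₀ dirac ⟪ ρ , P [ v ] ⟫

  par : ∀ {ρ P Q Δ} → ⟪ ρ , P ⟫ ⟶₀ Δ → ⟪ ρ , P ∥ Q ⟫ ⟶₀ mapProc (_∥ Q) Δ

  res : ∀ {ρ P c Δ} → ⟪ ρ , P ⟫ ⟶₀ Δ → ⟪ ρ , P ╲ c ⟫ ⟶₀ mapProc (_╲ c) Δ

  congr : ∀ {C C′ Δ Δ′} → C ≋ᶜ C′ → C′ ⟶₀ Δ′ → Δ′ ≋ᵈ Δ → C ⟶₀ Δ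

data _⟶_ (C : Conf) : Dist → Set₁ where
  step     : ∀ {Δ} → C ⟶₀ Δ → C ⟶ Δ
  deadlock : ¬ (∃[ Δ ] C ⟶₀ Δ) → C ⟶ dirac ⊥ᶜ

QubitSet : Set₁
QubitSet = Pred Qubit 0ℓ

names : QubitSet → NameSet 0
names Σ (qubit q) = Σ q

infix 3 _⊢ᶜ_ _⊢ᵈ_

data _⊢ᶜ_ : QubitSet × QubitSet → Conf → Set₁ where
  dead : ∀ {Σ Σ′} → (Σ , Σ′) ⊢ᶜ ⊥ᶜ
  conf : ∀ {Σ Σ′ ρ P} →
         Unique (register ρ) → Σ ≐ (_∈ register ρ) → IsDensity (operator ρ) →
         [] ⨾ names Σ′ ⊢ P → Σ′ ⊆ Σ →
         (Σ , Σ′) ⊢ᶜ ⟪ ρ , P ⟫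

record IsDistribution (Δ : Dist) : Set where
  field
    nonNegative : All (λ (p , _) → 0ᵣ ≤ᵣ p) Δ
    normalised  : List.foldr _+ᵣ_ 0ᵣ (List.map proj₁ Δ) ≈ᵣ 1ᵣ

record _⊢ᵈ_ (ΣΣ : QubitSet × QubitSet) (Δ : Dist) : Set₁ where
  field
    isDistribution : IsDistribution Δ
    support        : All (λ (p , C) → ¬ p ≈ᵣ 0ᵣ → ΣΣ ⊢ᶜ C) Δ

{-# OPTIONS --safe #-}
-- Typing is preserved because each ingredient of a reduction preserves it.
--
-- Processes: a process is typed by a single set Σ, so that structural congruence
-- preserves Σ even where an axiom introduces a new subprocess, and substituting
-- a qubit that does not yet occur in P acts injectively on the names in P.
--
-- States: ⟨ v ∣ K ρ K† ∣ v ⟩ = ⟨ K† v ∣ ρ ∣ K† v ⟩, and the operators Kᵢ at distinct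
-- positions again satisfy ∑ Kᵢ† Kᵢ = 𝟙, so that tr is preserved in total. After
-- a measurement, dividing by p = tr ρₘ is sound since p ≥ 0, p ≉ 0 and 0 ≤ p x
-- already give 0 ≤ x, without an inverse of p.
module Submission where

open import Defs
open import Algebra.Bundles using (CommutativeSemiring)
open import Data.Bool.Base using (Bool; true; false; if_then_else_)
import Data.Bool.Properties as Boolₚ
open import Data.Empty using (⊥-elim)
open import Data.Fin.Base using (Fin; zero; suc; toℕ)
import Data.Fin.Properties as Finₚ
open import Data.List.Base as List using (List; []; _∷_)
open import Data.List.Membership.Propositional using (_∈_)
open import Data.List.Membership.Propositional.Properties using (∈-map⁺; ∈-map⁻)
import Data.List.Properties as Listₚ
open import Data.List.Relation.Binary.Pointwise.Base using ([]; _∷_)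
open import Data.List.Relation.Unary.All as All using (All; []; _∷_)
import Data.List.Relation.Unary.All.Properties as Allₚ
open import Data.List.Relation.Unary.AllPairs using ([]; _∷_)
open import Data.List.Relation.Unary.Unique.Propositional using (Unique)
open import Data.Nat.Base as ℕ using (ℕ)
import Data.Nat.Properties as ℕₚ
open import Data.Product.Base as Product using (∃-syntax; _×_; _,_; proj₁; proj₂)
open import Data.Rational.Base as Rat using (ℚ; 0ℚ; 1ℚ; ½)
import Data.Rational.Properties as ℚₚ
open import Data.Rational.Solver using (module +-*-Solver)
open import Data.Sum.Base as Sum using (_⊎_; inj₁; inj₂)
open import Data.Vec.Base as Vec using (Vec; []; _∷_; lookup; _[_]≔_)
open import Data.Vec.Membership.Propositional using () renaming (_∈_ to _∈ᵥ_)
import Data.Vec.Properties as Vecₚ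
open import Data.Vec.Relation.Unary.All as VecAll using ([]; _∷_) renaming (All to Allᵥ)
import Data.Vec.Relation.Unary.All.Properties as VecAllₚ
open import Data.Vec.Relation.Unary.AllPairs using ([]; _∷_)
open import Data.Vec.Relation.Unary.Any using (here; there)
open import Data.Vec.Relation.Unary.Unique.Propositional using () renaming (Unique to Uniqueᵥ)
import Data.Vec.Relation.Unary.Unique.Propositional.Properties as Uniqueᵥₚ
open import Function.Base using (_∘_; id)
open import Function.Bundles using (mk⇔)
open import Level using (0ℓ)
open import Relation.Binary.PropositionalEquality.Core using (_≡_; _≢_; refl; sym; trans; cong; cong₂; subst; subst₂)
open import Relation.Nullary.Decidable using (Dec; yes; no; does; does-⇔; dec-true; dec-false; map′)
open import Relation.Nullary.Negation.Core using (¬_; contradiction)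
open import Relation.Unary using (_≐_; _∪_; _⊆_; ｛_｝; ∅)
open import Relation.Unary.Properties using (≐-refl; ≐-sym; ≐-trans)

-- Real numbers

-- Three obstacles shape the proof. Equality of Cauchy reals is not decidable, and membership of an
-- outcome in the support is the bare negation of p ≈ 0, from which no positive lower bound on p can
-- be read off; all case distinctions on numbers are therefore made on rational approximations.
--
-- Congruence can be used in either direction because of `≋-sym`, so every axiom has to reflect
-- typing as well as preserve it: an expression must be typable from its value, and a branch that
-- was dropped must be typable by the set of the branch that stayed.
--
-- Linearity links processes and states. Distinct arguments in the typing of `apply` and `measure`
-- yield distinct positions in the register, on which trace preservation depends; disjoint sets on
-- the two sides of a parallel composition make a received qubit fresh for the receiver. Reductions
-- keep the list of qubits in the register, so only the set of the process varies in the induction.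

Eventually : (ℕ → Set) → Set
Eventually P = ∃[ N ] ∀ n → N ℕ.≤ n → P n

always : ∀ {P} → (∀ n → P n) → Eventually P
always h = 0 , λ n _ → h n

both : ∀ {P Q R : ℕ → Set} → (∀ n → P n → Q n → R n) → Eventually P → Eventually Q → Eventually R
both f (N₁ , h₁) (N₂ , h₂) = N₁ ℕ.⊔ N₂ , λ n N≤n →
  f n (h₁ n (ℕₚ.m⊔n≤o⇒m≤o N₁ N₂ N≤n)) (h₂ n (ℕₚ.m⊔n≤o⇒n≤o N₁ N₂ N≤n))

each : ∀ {P Q : ℕ → Set} → (∀ n → P n → Q n) → Eventually P → Eventually Q
each f (N , h) = N , λ n N≤n → f n (h n N≤n)

module _ where
  open Rat using (_+_; _*_; -_; _-_; _<_; _≤_; ∣_∣; Positive; positive)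
  open ℚₚ.≤-Reasoning
  open CauchyClosure
  open ℝ using (seq)
  open +-*-Solver using (solve; _:+_; _:*_; :-_; _:-_; _:=_; con)

  private
    ∣p∣<r⇒p<r : ∀ {p r} → ∣ p ∣ < r → p < r
    ∣p∣<r⇒p<r {p} {r} h with 0ℚ ℚₚ.≤? p
    ... | yes 0≤p = subst (_< r) (ℚₚ.0≤p⇒∣p∣≡p 0≤p) h
    ... | no  0≰p = ℚₚ.<-trans (ℚₚ.≰⇒> 0≰p) (ℚₚ.≤-<-trans (ℚₚ.0≤∣p∣ p) h)

    ∣∣-< : ∀ {p r} → p < r → - p < r → ∣ p ∣ < r
    ∣∣-< {p} {r} p<r -p<r with ℚₚ.∣p∣≡p∨∣p∣≡-p p
    ... | inj₁ ∣p∣≡p = subst (_< r) (sym ∣p∣≡p) p<r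
    ... | inj₂ ∣p∣≡-p = subst (_< r) (sym ∣p∣≡-p) -p<r

    ∣p-q∣≡∣q-p∣ : ∀ p q → ∣ p - q ∣ ≡ ∣ q - p ∣
    ∣p-q∣≡∣q-p∣ p q = trans (cong ∣_∣ (solve 2 (λ p q → p :- q := :- (q :- p)) refl p q)) (ℚₚ.∣-p∣≡∣p∣ (q - p))

    sub-< : ∀ {p q ε} → p < q + ε → p - q < ε
    sub-< {p} {q} {ε} h = subst (p - q <_) (solve 2 (λ q ε → q :+ ε :- q := ε) refl q ε) (ℚₚ.+-monoˡ-< (- q) h)

    add-< : ∀ {p q ε} → p - q < ε → p < q + ε
    add-< {p} {q} {ε} h = subst₂ _<_ (sym (sub-add p q)) (ℚₚ.+-comm ε q) (ℚₚ.+-monoˡ-< q h)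

  abstract
    ≤-trans : ∀ {x y z} → x ≤ᵣ y → y ≤ᵣ z → x ≤ᵣ z
    ≤-trans {x} {y} {z} (mk≤ x≤y) (mk≤ y≤z) = mk≤ λ ε 0<ε →
      both (λ n p q → begin-strict
        seq x n                        <⟨ p ⟩
        seq y n + ½ * ε                <⟨ ℚₚ.+-monoˡ-< (½ * ε) q ⟩
        seq z n + ½ * ε + ½ * ε        ≡⟨ ℚₚ.+-assoc (seq z n) (½ * ε) (½ * ε) ⟩
        seq z n + (½ * ε + ½ * ε)      ≡⟨ cong (seq z n +_) (halves ε) ⟩
        seq z n + ε                    ∎)
      (x≤y (½ * ε) (half-pos 0<ε)) (y≤z (½ * ε) (half-pos 0<ε))

    ≈⇒≤ : ∀ {x y} → x ≈ᵣ y → x ≤ᵣ y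
    ≈⇒≤ {x} {y} (mk≈ x≈y) = mk≤ λ ε 0<ε → each (λ n p → add-< {seq x n} (∣p∣<r⇒p<r p)) (x≈y ε 0<ε)

    ≤-antisym : ∀ {x y} → x ≤ᵣ y → y ≤ᵣ x → x ≈ᵣ y
    ≤-antisym {x} {y} (mk≤ x≤y) (mk≤ y≤x) = mk≈ λ ε 0<ε →
      both (λ n p q → ∣∣-< (sub-< {seq x n} p)
             (subst (_< ε) (solve 2 (λ p q → q :- p := :- (p :- q)) refl (seq x n) (seq y n)) (sub-< {seq y n} q)))
        (x≤y ε 0<ε) (y≤x ε 0<ε)

    ≈-sym : ∀ {x y} → x ≈ᵣ y → y ≈ᵣ x
    ≈-sym {x} {y} (mk≈ x≈y) = mk≈ λ ε 0<ε →
      each (λ n → subst (_< ε) (∣p-q∣≡∣q-p∣ (seq x n) (seq y n))) (x≈y ε 0<ε)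

    ≗⇒≈ : ∀ {x y} → (∀ n → seq x n ≡ seq y n) → x ≈ᵣ y
    ≗⇒≈ {x} {y} x≗y = mk≈ λ ε 0<ε → always λ n →
      subst (_< ε) (sym (trans (cong (λ p → ∣ p - seq y n ∣) (x≗y n)) (cong ∣_∣ (ℚₚ.+-inverseʳ (seq y n))))) 0<ε

    +-mono-≤ : ∀ {x y u v} → x ≤ᵣ y → u ≤ᵣ v → x +ᵣ u ≤ᵣ y +ᵣ v
    +-mono-≤ {real x _} {real y _} {real u _} {real v _} (mk≤ x≤y) (mk≤ u≤v) = mk≤ λ ε 0<ε →
      both (λ n p q → begin-strict
        x n + u n                          <⟨ ℚₚ.+-mono-< p q ⟩
        (y n + ½ * ε) + (v n + ½ * ε)      ≡⟨ solve 4 (λ a b c d → (a :+ b) :+ (c :+ d) := (a :+ c) :+ (b :+ d)) refl (y n) (½ * ε) (v n) (½ * ε) ⟩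
        (y n + v n) + (½ * ε + ½ * ε)      ≡⟨ cong (y n + v n +_) (halves ε) ⟩
        (y n + v n) + ε                    ∎)
      (x≤y (½ * ε) (half-pos 0<ε)) (u≤v (½ * ε) (half-pos 0<ε))

    neg-antimono-≤ : ∀ {x y} → x ≤ᵣ y → -ᵣ y ≤ᵣ -ᵣ x
    neg-antimono-≤ {real x _} {real y _} (mk≤ x≤y) = mk≤ λ ε 0<ε →
      each (λ n p → add-< { - y n} (subst (_< ε) (solve 2 (λ x y → x :- y := (:- y) :- (:- x)) refl (x n) (y n)) (sub-< {x n} p))) (x≤y ε 0<ε)

    -- x u - y v = x (u - v) + v (x - y), where x and v are eventually bounded; `shrink` turns the
    -- two bounds into tolerances for the two differences.
    *-cong : ∀ {x y u v} → x ≈ᵣ y → u ≈ᵣ v → x *ᵣ u ≈ᵣ y *ᵣ v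
    *-cong {real x cx} {real y cy} {real u cu} {real v cv} (mk≈ x≈y) (mk≈ u≈v) = mk≈ λ ε 0<ε →
      let A , N₁ , 0<A , x<A = bounded {x} cx
          B , N₂ , 0<B , v<B = bounded {v} cv
          δ , 0<δ , sx = shrink 0<A (half-pos 0<ε)
          η , 0<η , sv = shrink 0<B (half-pos 0<ε)
      in both (λ n p q → begin-strict
           ∣ x n * u n - y n * v n ∣                      ≡⟨ cong ∣_∣ (*-regroup (x n) (u n) (y n) (v n)) ⟩
           ∣ x n * (u n - v n) + v n * (x n - y n) ∣      ≤⟨ ℚₚ.∣p+q∣≤∣p∣+∣q∣ (x n * (u n - v n)) (v n * (x n - y n)) ⟩
           ∣ x n * (u n - v n) ∣ + ∣ v n * (x n - y n) ∣  <⟨ ℚₚ.+-mono-< p q ⟩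
           ½ * ε + ½ * ε                                  ≡⟨ halves ε ⟩
           ε                                              ∎)
         (both (λ n → sx (x n) (u n - v n)) (N₁ , x<A) (u≈v δ 0<δ))
         (both (λ n → sv (v n) (x n - y n)) (N₂ , v<B) (x≈y η 0<η))

    -- A negative x would force p below every positive bound.
    0≤p*x⇒0≤x : ∀ {p x} → 0ᵣ ≤ᵣ p → ¬ p ≈ᵣ 0ᵣ → 0ᵣ ≤ᵣ p *ᵣ x → 0ᵣ ≤ᵣ x
    0≤p*x⇒0≤x {real p cp} {real x cx} 0≤p p≉0 (mk≤ 0≤px) = mk≤ lower
      where
      lower : ∀ ε → 0ℚ < ε → Eventually (λ n → 0ℚ < x n + ε)
      -- With tolerance ε/4, comparing the single rational `x N` with -ε/2 settles the whole tail:
      -- either it stays above -3ε/4, or it stays below -ε/4.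
      lower ε 0<ε with cx (½ * (½ * ε)) (half-pos (half-pos 0<ε))
      ... | N , near = decide (x N ℚₚ.<? - (½ * ε))
        where
        δ : ℚ
        δ = ½ * (½ * ε)
        0<δ : 0ℚ < δ
        0<δ = half-pos (half-pos 0<ε)
        instance
          δ⁺ : Positive δ
          δ⁺ = positive 0<δ
        decide : Dec (x N < - (½ * ε)) → Eventually (λ n → 0ℚ < x n + ε)
        decide (no xN≮) = N , λ n N≤n → begin-strict
          0ℚ                                 <⟨ 0<δ ⟩
          δ                                  ≡⟨ solve 1 (λ e → con ½ :* (con ½ :* e) := (:- (con ½ :* e)) :- con ½ :* (con ½ :* e) :+ e) refl ε ⟩
          - (½ * ε) - δ + ε                  ≤⟨ ℚₚ.+-monoˡ-≤ ε (ℚₚ.+-monoˡ-≤ (- δ) (ℚₚ.≮⇒≥ xN≮)) ⟩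
          x N - δ + ε                        <⟨ ℚₚ.+-monoˡ-< ε (subst (x N - δ <_) (solve 2 (λ d y → y :+ d :- d := y) refl δ (x n)) (ℚₚ.+-monoˡ-< (- δ) (add-< {x N} (∣p∣<r⇒p<r (near N n ℕₚ.≤-refl N≤n))))) ⟩
          x n + ε                            ∎
        decide (yes xN<) = contradiction p≈0 p≉0
          where
          x<-δ : ∀ n → N ℕ.≤ n → x n < - δ
          x<-δ n N≤n = begin-strict
            x n             <⟨ add-< {x n} (∣p∣<r⇒p<r (near n N N≤n ℕₚ.≤-refl)) ⟩
            x N + δ         <⟨ ℚₚ.+-monoˡ-< δ xN< ⟩
            - (½ * ε) + δ   ≡⟨ solve 1 (λ e → (:- (con ½ :* e)) :+ con ½ :* (con ½ :* e) := :- (con ½ :* (con ½ :* e))) refl ε ⟩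
            - δ             ∎
          -- If p were at least η, then p x ≤ η x < - δ η, against the lower bound on p x.
          p<η : ∀ η → 0ℚ < η → ∀ p x → x < - δ → 0ℚ < p * x + δ * η → p < 0ℚ + η
          p<η η 0<η p x x< 0<px with p ℚₚ.<? 0ℚ + η
          ... | yes p<η = p<η
          ... | no p≮η = contradiction 0<px (ℚₚ.<-asym (begin-strict
            p * x + δ * η     ≤⟨ ℚₚ.+-monoˡ-≤ (δ * η) (ℚₚ.*-monoʳ-≤-nonPos x {{Rat.nonPositive (ℚₚ.<⇒≤ (ℚₚ.<-trans x< (ℚₚ.neg-antimono-< 0<δ)))}} (subst (_≤ p) (ℚₚ.+-identityˡ η) (ℚₚ.≮⇒≥ p≮η))) ⟩
            η * x + δ * η     <⟨ ℚₚ.+-monoˡ-< (δ * η) (ℚₚ.*-monoʳ-<-pos η {{positive 0<η}} x<) ⟩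
            η * - δ + δ * η   ≡⟨ solve 2 (λ e d → e :* (:- d) :+ d :* e := con 0ℚ) refl η δ ⟩
            0ℚ                ∎))
          δη⁺ : ∀ {η} → 0ℚ < η → 0ℚ < δ * η
          δη⁺ {η} 0<η = ℚₚ.positive⁻¹ (δ * η) {{ℚₚ.pos*pos⇒pos δ η {{positive 0<η}}}}
          p≈0 : real p cp ≈ᵣ 0ᵣ
          -- The hypothesis 0 ≤ p x is used with tolerance δ η, which is what bounds p by η itself.
          p≈0 = ≤-antisym (mk≤ λ η 0<η → both (λ n → p<η η 0<η (p n) (x n)) (N , x<-δ) (0≤px (δ * η) (δη⁺ 0<η))) 0≤p

≤-refl : ∀ {x} → x ≤ᵣ x
≤-refl = ≈⇒≤ (≗⇒≈ λ _ → refl)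

≈-refl : ∀ {x} → x ≈ᵣ x
≈-refl = ≗⇒≈ λ _ → refl

-- Equality is inequality in both directions, so the estimates behind `≤-trans`, `+-mono-≤` and
-- `neg-antimono-≤` also give the laws of `_≈ᵣ_`.
≈-trans : ∀ {x y z} → x ≈ᵣ y → y ≈ᵣ z → x ≈ᵣ z
≈-trans x≈y y≈z = ≤-antisym (≤-trans (≈⇒≤ x≈y) (≈⇒≤ y≈z)) (≤-trans (≈⇒≤ (≈-sym y≈z)) (≈⇒≤ (≈-sym x≈y)))

+-cong : ∀ {x y u v} → x ≈ᵣ y → u ≈ᵣ v → x +ᵣ u ≈ᵣ y +ᵣ v
+-cong x≈y u≈v =
  ≤-antisym (+-mono-≤ (≈⇒≤ x≈y) (≈⇒≤ u≈v)) (+-mono-≤ (≈⇒≤ (≈-sym x≈y)) (≈⇒≤ (≈-sym u≈v)))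

neg-cong : ∀ {x y} → x ≈ᵣ y → -ᵣ x ≈ᵣ -ᵣ y
neg-cong x≈y = ≤-antisym (neg-antimono-≤ (≈⇒≤ (≈-sym x≈y))) (neg-antimono-≤ (≈⇒≤ x≈y))

-- Unlike _≈ᶜ_, this determines its arguments by unification.
infix 4 _≃_
record _≃_ (z w : ℂ) : Set where
  constructor entrywise
  field
    parts : z ≈ᶜ w
open _≃_

re-cong : ∀ {z w} → z ≃ w → re z ≈ᵣ re w
re-cong z≃w = proj₁ (parts z≃w)

im-cong : ∀ {z w} → z ≃ w → im z ≈ᵣ im w
im-cong z≃w = proj₂ (parts z≃w)

open +-*-Solver using (solve; _:+_; _:*_; :-_; _:=_; con)

abstract
  ≃-refl : ∀ {z} → z ≃ z
  ≃-refl = entrywise (≈-refl , ≈-refl)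

  ≃-sym : ∀ {z w} → z ≃ w → w ≃ z
  ≃-sym (entrywise (p , q)) = entrywise (≈-sym p , ≈-sym q)

  ≃-trans : ∀ {z w t} → z ≃ w → w ≃ t → z ≃ t
  ≃-trans (entrywise (p , q)) (entrywise (r , s)) = entrywise (≈-trans p r , ≈-trans q s)

  +ᶜ-cong : ∀ {z w s t} → z ≃ w → s ≃ t → z +ᶜ s ≃ w +ᶜ t
  +ᶜ-cong {_ +i _} {_ +i _} {_ +i _} {_ +i _} (entrywise (p , q)) (entrywise (r , s)) =
    entrywise (+-cong p r , +-cong q s)

  *ᶜ-cong : ∀ {z w s t} → z ≃ w → s ≃ t → z *ᶜ s ≃ w *ᶜ t
  *ᶜ-cong {_ +i _} {_ +i _} {_ +i _} {_ +i _} (entrywise (p , q)) (entrywise (r , s)) =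
    entrywise (+-cong (*-cong p r) (neg-cong (*-cong q s)) , +-cong (*-cong p s) (*-cong q r))

  -- In the laws below the real and imaginary parts of the two sides agree term by
  -- term in ℚ.
  +ᶜ-assoc : ∀ z w t → z +ᶜ w +ᶜ t ≃ z +ᶜ (w +ᶜ t)
  +ᶜ-assoc (real a _ +i real b _) (real c _ +i real d _) (real e _ +i real f _) = entrywise
    ( ≗⇒≈ (λ n → ℚₚ.+-assoc (a n) (c n) (e n)) , ≗⇒≈ (λ n → ℚₚ.+-assoc (b n) (d n) (f n)))

  +ᶜ-identityˡ : ∀ z → 0ᶜ +ᶜ z ≃ z
  +ᶜ-identityˡ (real a _ +i real b _) = entrywise
    ( ≗⇒≈ (λ n → ℚₚ.+-identityˡ (a n)) , ≗⇒≈ (λ n → ℚₚ.+-identityˡ (b n)))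

  +ᶜ-comm : ∀ z w → z +ᶜ w ≃ w +ᶜ z
  +ᶜ-comm (real a _ +i real b _) (real c _ +i real d _) = entrywise
    ( ≗⇒≈ (λ n → ℚₚ.+-comm (a n) (c n)) , ≗⇒≈ (λ n → ℚₚ.+-comm (b n) (d n)))

  *ᶜ-assoc : ∀ z w t → z *ᶜ w *ᶜ t ≃ z *ᶜ (w *ᶜ t)
  *ᶜ-assoc (real a _ +i real b _) (real c _ +i real d _) (real e _ +i real f _) = entrywise
    ( ≗⇒≈ (λ n → solve 6 (λ a b c d e f →
        (a :* c :+ :- (b :* d)) :* e :+ :- ((a :* d :+ b :* c) :* f) :=
        a :* (c :* e :+ :- (d :* f)) :+ :- (b :* (c :* f :+ d :* e))) refl (a n) (b n) (c n) (d n) (e n) (f n))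
    , ≗⇒≈ (λ n → solve 6 (λ a b c d e f →
        (a :* c :+ :- (b :* d)) :* f :+ (a :* d :+ b :* c) :* e :=
        a :* (c :* f :+ d :* e) :+ b :* (c :* e :+ :- (d :* f))) refl (a n) (b n) (c n) (d n) (e n) (f n)))

  *ᶜ-identityˡ : ∀ z → 1ᶜ *ᶜ z ≃ z
  *ᶜ-identityˡ (real a _ +i real b _) = entrywise
    ( ≗⇒≈ (λ n → solve 2 (λ a b → con 1ℚ :* a :+ :- (con 0ℚ :* b) := a) refl (a n) (b n))
    , ≗⇒≈ (λ n → solve 2 (λ a b → con 1ℚ :* b :+ con 0ℚ :* a := b) refl (a n) (b n)))

  *ᶜ-comm : ∀ z w → z *ᶜ w ≃ w *ᶜ z
  *ᶜ-comm (real a _ +i real b _) (real c _ +i real d _) = entrywise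
    ( ≗⇒≈ (λ n → solve 4 (λ a b c d → a :* c :+ :- (b :* d) := c :* a :+ :- (d :* b)) refl (a n) (b n) (c n) (d n))
    , ≗⇒≈ (λ n → solve 4 (λ a b c d → a :* d :+ b :* c := c :* b :+ d :* a) refl (a n) (b n) (c n) (d n)))

  *ᶜ-distribˡ-+ᶜ : ∀ z w t → z *ᶜ (w +ᶜ t) ≃ z *ᶜ w +ᶜ z *ᶜ t
  *ᶜ-distribˡ-+ᶜ (real a _ +i real b _) (real c _ +i real d _) (real e _ +i real f _) = entrywise
    ( ≗⇒≈ (λ n → solve 6 (λ a b c d e f →
        a :* (c :+ e) :+ :- (b :* (d :+ f)) :=
        (a :* c :+ :- (b :* d)) :+ (a :* e :+ :- (b :* f))) refl (a n) (b n) (c n) (d n) (e n) (f n))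
    , ≗⇒≈ (λ n → solve 6 (λ a b c d e f →
        a :* (d :+ f) :+ b :* (c :+ e) :=
        (a :* d :+ b :* c) :+ (a :* f :+ b :* e)) refl (a n) (b n) (c n) (d n) (e n) (f n)))

  *ᶜ-zeroˡ : ∀ z → 0ᶜ *ᶜ z ≃ 0ᶜ
  *ᶜ-zeroˡ (real a _ +i real b _) = entrywise
    ( ≗⇒≈ (λ n → solve 2 (λ a b → con 0ℚ :* a :+ :- (con 0ℚ :* b) := con 0ℚ) refl (a n) (b n))
    , ≗⇒≈ (λ n → solve 2 (λ a b → con 0ℚ :* b :+ con 0ℚ :* a := con 0ℚ) refl (a n) (b n)))

  conj-+ : ∀ z w → conj (z +ᶜ w) ≃ conj z +ᶜ conj w
  conj-+ (real a _ +i real b _) (real c _ +i real d _) = entrywise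
    (≈-refl , ≗⇒≈ (λ n → ℚₚ.neg-distrib-+ (b n) (d n)))

  conj-* : ∀ z w → conj (z *ᶜ w) ≃ conj z *ᶜ conj w
  conj-* (real a _ +i real b _) (real c _ +i real d _) = entrywise
    ( ≗⇒≈ (λ n → solve 4 (λ a b c d → a :* c :+ :- (b :* d) := a :* c :+ :- ((:- b) :* (:- d))) refl (a n) (b n) (c n) (d n))
    , ≗⇒≈ (λ n → solve 4 (λ a b c d → :- (a :* d :+ b :* c) := a :* (:- d) :+ (:- b) :* c) refl (a n) (b n) (c n) (d n)))

  conj-conj : ∀ z → conj (conj z) ≃ z
  conj-conj (real a _ +i real b _) = entrywise
    (≈-refl , ≗⇒≈ (λ n → solve 1 (λ b → :- (:- b) := b) refl (b n)))

  conj-0 : conj 0ᶜ ≃ 0ᶜ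
  conj-0 = entrywise (≈-refl , ≗⇒≈ λ _ → refl)

  conj-1 : conj 1ᶜ ≃ 1ᶜ
  conj-1 = entrywise (≈-refl , ≗⇒≈ λ _ → refl)

  re-+ : ∀ z w → re (z +ᶜ w) ≡ re z +ᵣ re w
  re-+ (_ +i _) (_ +i _) = refl

  re-scale : ∀ p z → re ((p +i 0ᵣ) *ᶜ z) ≈ᵣ p *ᵣ re z
  re-scale (real p _) (real a _ +i real b _) =
    ≗⇒≈ (λ n → solve 3 (λ p a b → p :* a :+ :- (con 0ℚ :* b) := p :* a) refl (p n) (a n) (b n))

  im-scale : ∀ p z → im ((p +i 0ᵣ) *ᶜ z) ≈ᵣ p *ᵣ im z
  im-scale (real p _) (real a _ +i real b _) =
    ≗⇒≈ (λ n → solve 3 (λ p a b → p :* b :+ con 0ℚ :* a := p :* b) refl (p n) (a n) (b n))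

-- Over this bundle the library's `sum` unfolds to the very fold in `∑ₒ`, so its laws apply to sums
-- of Kraus operators as they stand.
ℂ-commutativeSemiring : CommutativeSemiring 0ℓ 0ℓ
ℂ-commutativeSemiring = record
  { Carrier = ℂ
  ; _≈_ = _≃_
  ; _+_ = _+ᶜ_
  ; _*_ = _*ᶜ_
  ; 0# = 0ᶜ
  ; 1# = 1ᶜ
  ; isCommutativeSemiring = isCommutativeSemiringˡ record
    { +-isCommutativeMonoid = isCommutativeMonoidˡ record
      { isSemigroup = record { isMagma = record { isEquivalence = isEquiv ; ∙-cong = +ᶜ-cong } ; assoc = +ᶜ-assoc }
      ; identityˡ = +ᶜ-identityˡ
      ; comm = +ᶜ-comm
      }
    ; *-isCommutativeMonoid = isCommutativeMonoidˡ record
      { isSemigroup = record { isMagma = record { isEquivalence = isEquiv ; ∙-cong = *ᶜ-cong } ; assoc = *ᶜ-assoc }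
      ; identityˡ = *ᶜ-identityˡ
      ; comm = *ᶜ-comm
      }
    ; distribʳ = λ z w t → ≃-trans (*ᶜ-comm (w +ᶜ t) z)
        (≃-trans (*ᶜ-distribˡ-+ᶜ z w t) (+ᶜ-cong (*ᶜ-comm z w) (*ᶜ-comm z t)))
    ; zeroˡ = *ᶜ-zeroˡ
    }
  }
  where
  open import Algebra.Structures.Biased _≃_
  open import Relation.Binary.Structures using (IsEquivalence)
  isEquiv : IsEquivalence _≃_
  isEquiv = record { refl = ≃-refl ; sym = ≃-sym ; trans = ≃-trans }

-- Operators

private module ℂₛ = CommutativeSemiring ℂ-commutativeSemiring
open import Algebra.Properties.CommutativeSemigroup ℂₛ.*-commutativeSemigroup using (x∙yz≈y∙xz)
open import Algebra.Properties.CommutativeSemigroup ℂₛ.+-commutativeSemigroup using (interchange)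
open import Algebra.Properties.Semiring.Sum ℂₛ.semiring
  using (sum; sum-cong-≋; sum-replicate-zero; *-distribˡ-sum; *-distribʳ-sum)
open import Relation.Binary.Reasoning.Setoid ℂₛ.setoid

-- Sums over a basis have no empty case, so preservation of _+ᶜ_ suffices.
∑-homo : ∀ n (h : ℂ → ℂ) → (∀ z w → h (z +ᶜ w) ≃ h z +ᶜ h w) →
         ∀ (f : Basis n → ℂ) → h (∑ f) ≃ ∑ (h ∘ f)
∑-homo ℕ.zero    h h-+ f = ℂₛ.refl
∑-homo (ℕ.suc n) h h-+ f = ℂₛ.trans (h-+ _ _) (ℂₛ.+-cong (∑-homo n h h-+ _) (∑-homo n h h-+ _))

∑-cong : ∀ n {f g : Basis n → ℂ} → (∀ b → f b ≃ g b) → ∑ f ≃ ∑ g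
∑-cong ℕ.zero    f≃g = f≃g []
∑-cong (ℕ.suc n) f≃g = ℂₛ.+-cong (∑-cong n (f≃g ∘ (false ∷_))) (∑-cong n (f≃g ∘ (true ∷_)))

∑-zero : ∀ n {f : Basis n → ℂ} → (∀ b → f b ≃ 0ᶜ) → ∑ f ≃ 0ᶜ
∑-zero ℕ.zero    f≃0 = f≃0 []
∑-zero (ℕ.suc n) f≃0 =
  ℂₛ.trans (ℂₛ.+-cong (∑-zero n (f≃0 ∘ (false ∷_))) (∑-zero n (f≃0 ∘ (true ∷_)))) (ℂₛ.+-identityˡ 0ᶜ)

∑-distrib-+ : ∀ n (f g : Basis n → ℂ) → ∑ (λ b → f b +ᶜ g b) ≃ ∑ f +ᶜ ∑ g
∑-distrib-+ ℕ.zero    f g = ℂₛ.refl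
∑-distrib-+ (ℕ.suc n) f g = ℂₛ.trans
  (ℂₛ.+-cong (∑-distrib-+ n (f ∘ (false ∷_)) (g ∘ (false ∷_))) (∑-distrib-+ n (f ∘ (true ∷_)) (g ∘ (true ∷_))))
  (interchange _ _ _ _)

∑-comm : ∀ m n (f : Basis m → Basis n → ℂ) → (∑ λ b → ∑ λ c → f b c) ≃ (∑ λ c → ∑ λ b → f b c)
∑-comm ℕ.zero    n f = ℂₛ.refl
∑-comm (ℕ.suc m) n f = ℂₛ.trans
  (ℂₛ.+-cong (∑-comm m n (f ∘ (false ∷_))) (∑-comm m n (f ∘ (true ∷_)))) (ℂₛ.sym (∑-distrib-+ n _ _))

∑-sum-comm : ∀ k n (f : Fin k → Basis n → ℂ) → (sum λ i → ∑ (f i)) ≃ (∑ λ b → sum λ i → f i b)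
∑-sum-comm ℕ.zero    n f = ℂₛ.sym (∑-zero n λ _ → ℂₛ.refl)
∑-sum-comm (ℕ.suc k) n f =
  ℂₛ.trans (ℂₛ.+-congˡ (∑-sum-comm k n (f ∘ suc))) (ℂₛ.sym (∑-distrib-+ n (f zero) _))

∑-*ˡ : ∀ n z (f : Basis n → ℂ) → z *ᶜ ∑ f ≃ (∑ λ b → z *ᶜ f b)
∑-*ˡ n z = ∑-homo n (z *ᶜ_) (ℂₛ.distribˡ z)

∑-*ʳ : ∀ n z (f : Basis n → ℂ) → ∑ f *ᶜ z ≃ (∑ λ b → f b *ᶜ z)
∑-*ʳ n z = ∑-homo n (_*ᶜ z) (ℂₛ.distribʳ z)

∑-only : ∀ {n} (b : Basis n) (f : Basis n → ℂ) → (∀ d → d ≢ b → f d ≃ 0ᶜ) → ∑ f ≃ f b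
∑-only []          f f≃0 = ℂₛ.refl
∑-only (false ∷ b) f f≃0 = ℂₛ.trans
  (ℂₛ.+-cong (∑-only b (f ∘ (false ∷_)) λ d d≢b → f≃0 (false ∷ d) (d≢b ∘ Vecₚ.∷-injectiveʳ))
             (∑-zero _ λ d → f≃0 (true ∷ d) λ ()))
  (ℂₛ.+-identityʳ _)
∑-only (true ∷ b)  f f≃0 = ℂₛ.trans
  (ℂₛ.+-cong (∑-zero _ λ d → f≃0 (false ∷ d) λ ())
             (∑-only b (f ∘ (true ∷_)) λ d d≢b → f≃0 (true ∷ d) (d≢b ∘ Vecₚ.∷-injectiveʳ)))
  (ℂₛ.+-identityˡ _)

if-true : ∀ {A : Set} {P : Set} (P? : Dec P) {x y : A} → P → (if does P? then x else y) ≡ x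
if-true P? {x} {y} p = cong (if_then x else y) (dec-true P? p)

if-false : ∀ {A : Set} {P : Set} (P? : Dec P) {x y : A} → ¬ P → (if does P? then x else y) ≡ y
if-false P? {x} {y} ¬p = cong (if_then x else y) (dec-false P? ¬p)

𝟙-diagonal : ∀ {n} {b c : Basis n} → b ≡ c → 𝟙 b c ≡ 1ᶜ
𝟙-diagonal {b = b} {c} = if-true (Vecₚ.≡-dec Boolₚ._≟_ b c)

𝟙-off-diagonal : ∀ {n} {b c : Basis n} → b ≢ c → 𝟙 b c ≡ 0ᶜ
𝟙-off-diagonal {b = b} {c} = if-false (Vecₚ.≡-dec Boolₚ._≟_ b c)

-- Inner products, expectations and traces

infixr 7 _·_

_·_ : ∀ {n} → Operator n → Ket n → Ket n
(A · v) b = ∑ λ c → A b c *ᶜ v c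

inner : ∀ {n} → Ket n → Ket n → ℂ
inner v w = ∑ λ b → conj (v b) *ᶜ w b

∙-· : ∀ {n} (A B : Operator n) (v : Ket n) b → ((A ∙ B) · v) b ≃ (A · B · v) b
∙-· {n} A B v b = begin
  (∑ λ c → (∑ λ d → A b d *ᶜ B d c) *ᶜ v c)      ≈⟨ ∑-cong _ (λ c → ∑-*ʳ n (v c) _) ⟩
  (∑ λ c → ∑ λ d → A b d *ᶜ B d c *ᶜ v c)        ≈⟨ ∑-comm _ _ (λ c d → A b d *ᶜ B d c *ᶜ v c) ⟩
  (∑ λ d → ∑ λ c → A b d *ᶜ B d c *ᶜ v c)        ≈⟨ ∑-cong _ (λ d → ∑-cong _ λ c → ℂₛ.*-assoc (A b d) (B d c) (v c)) ⟩
  (∑ λ d → ∑ λ c → A b d *ᶜ (B d c *ᶜ v c))      ≈⟨ ∑-cong _ (λ d → ∑-*ˡ n (A b d) _) ⟨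
  (∑ λ d → A b d *ᶜ (∑ λ c → B d c *ᶜ v c))      ∎

-- Column `c` of a product is the left factor acting on column `c` of the right one, so this is
-- `∙-·` for a column of `C`.
∙-assoc : ∀ {n} (A B C : Operator n) b c → (A ∙ B ∙ C) b c ≃ (A ∙ (B ∙ C)) b c
∙-assoc A B C b c = ∙-· A B (λ d → C d c) b

inner-† : ∀ {n} (A : Operator n) (v w : Ket n) → inner v (A · w) ≃ inner (A † · v) w
inner-† {n} A v w = begin
  (∑ λ b → conj (v b) *ᶜ (∑ λ c → A b c *ᶜ w c))          ≈⟨ ∑-cong _ (λ b → ∑-*ˡ n (conj (v b)) _) ⟩
  (∑ λ b → ∑ λ c → conj (v b) *ᶜ (A b c *ᶜ w c))          ≈⟨ ∑-comm _ _ (λ b c → conj (v b) *ᶜ (A b c *ᶜ w c)) ⟩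
  (∑ λ c → ∑ λ b → conj (v b) *ᶜ (A b c *ᶜ w c))          ≈⟨ ∑-cong _ (λ c → ∑-cong _ (term c)) ⟨
  (∑ λ c → ∑ λ b → conj ((A †) c b *ᶜ v b) *ᶜ w c)        ≈⟨ ∑-cong _ (λ c → ∑-*ʳ n (w c) _) ⟨
  (∑ λ c → (∑ λ b → conj ((A †) c b *ᶜ v b)) *ᶜ w c)      ≈⟨ ∑-cong n (λ c → ℂₛ.*-congʳ {w c} (∑-homo n conj conj-+ _)) ⟨
  (∑ λ c → conj ((A † · v) c) *ᶜ w c)                     ∎
  where
  term : ∀ c b → conj (conj (A b c) *ᶜ v b) *ᶜ w c ≃ conj (v b) *ᶜ (A b c *ᶜ w c)
  term c b = begin
    conj (conj (A b c) *ᶜ v b) *ᶜ w c           ≈⟨ ℂₛ.*-congʳ (conj-* (conj (A b c)) (v b)) ⟩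
    conj (conj (A b c)) *ᶜ conj (v b) *ᶜ w c    ≈⟨ ℂₛ.*-congʳ (ℂₛ.*-congʳ (conj-conj (A b c))) ⟩
    A b c *ᶜ conj (v b) *ᶜ w c                  ≈⟨ ℂₛ.*-congʳ (ℂₛ.*-comm (A b c) (conj (v b))) ⟩
    conj (v b) *ᶜ A b c *ᶜ w c                  ≈⟨ ℂₛ.*-assoc (conj (v b)) (A b c) (w c) ⟩
    conj (v b) *ᶜ (A b c *ᶜ w c)                ∎

expectation-inner : ∀ {n} (A : Operator n) (v w : Ket n) → ⟨ v ∣ A ∣ w ⟩ ≃ inner v (A · w)
expectation-inner {n} A v w = ∑-cong _ λ b → ℂₛ.sym (∑-*ˡ n (conj (v b)) _)

expectation-conjugate : ∀ {n} (K ρ : Operator n) (v : Ket n) →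
                        ⟨ v ∣ K ∙ ρ ∙ K † ∣ v ⟩ ≃ ⟨ K † · v ∣ ρ ∣ K † · v ⟩
expectation-conjugate K ρ v = begin
  ⟨ v ∣ K ∙ ρ ∙ K † ∣ v ⟩          ≈⟨ expectation-inner (K ∙ ρ ∙ K †) v v ⟩
  inner v ((K ∙ ρ ∙ K †) · v)      ≈⟨ ∑-cong _ (λ b → ℂₛ.*-congˡ (ℂₛ.trans (∙-· (K ∙ ρ) (K †) v b) (∙-· K ρ (K † · v) b))) ⟩
  inner v (K · ρ · K † · v)        ≈⟨ inner-† K v (ρ · K † · v) ⟩
  inner (K † · v) (ρ · K † · v)    ≈⟨ expectation-inner ρ (K † · v) (K † · v) ⟨
  ⟨ K † · v ∣ ρ ∣ K † · v ⟩        ∎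

expectation-cong : ∀ {n} {A B : Operator n} → A ≈ₒ B → ∀ v w → ⟨ v ∣ A ∣ w ⟩ ≃ ⟨ v ∣ B ∣ w ⟩
expectation-cong A≈B v w = ∑-cong _ λ b → ∑-cong _ λ c → ℂₛ.*-congˡ (ℂₛ.*-congʳ (entrywise (A≈B b c)))

expectation-∑ₒ : ∀ {k n} (A : Fin k → Operator n) v w → ⟨ v ∣ ∑ₒ A ∣ w ⟩ ≃ (sum λ i → ⟨ v ∣ A i ∣ w ⟩)
expectation-∑ₒ A v w = begin
  (∑ λ b → ∑ λ c → conj (v b) *ᶜ ((sum λ i → A i b c) *ᶜ w c))    ≈⟨ ∑-cong _ (λ b → ∑-cong _ λ c → term b c) ⟩
  (∑ λ b → ∑ λ c → sum λ i → conj (v b) *ᶜ (A i b c *ᶜ w c))      ≈⟨ ∑-cong _ (λ b → ∑-sum-comm _ _ λ i c → conj (v b) *ᶜ (A i b c *ᶜ w c)) ⟨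
  (∑ λ b → sum λ i → ∑ λ c → conj (v b) *ᶜ (A i b c *ᶜ w c))      ≈⟨ ∑-sum-comm _ _ (λ i b → ∑ λ c → conj (v b) *ᶜ (A i b c *ᶜ w c)) ⟨
  (sum λ i → ⟨ v ∣ A i ∣ w ⟩)                                     ∎
  where
  term : ∀ b c → conj (v b) *ᶜ ((sum λ i → A i b c) *ᶜ w c) ≃ (sum λ i → conj (v b) *ᶜ (A i b c *ᶜ w c))
  term b c = ℂₛ.trans (ℂₛ.*-congˡ (*-distribʳ-sum (w c) (λ i → A i b c))) (*-distribˡ-sum (conj (v b)) (λ i → A i b c *ᶜ w c))

expectation-• : ∀ {n} p (A : Operator n) v w → ⟨ v ∣ p • A ∣ w ⟩ ≃ (p +i 0ᵣ) *ᶜ ⟨ v ∣ A ∣ w ⟩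
expectation-• {n} p A v w = ℂₛ.sym (ℂₛ.trans (∑-*ˡ n _ _) (∑-cong _ λ b → ℂₛ.trans (∑-*ˡ n _ _) (∑-cong _ λ c → term b c)))
  where
  term : ∀ b c → (p +i 0ᵣ) *ᶜ (conj (v b) *ᶜ (A b c *ᶜ w c)) ≃ conj (v b) *ᶜ ((p +i 0ᵣ) *ᶜ A b c *ᶜ w c)
  term b c = ℂₛ.trans (x∙yz≈y∙xz _ _ _) (ℂₛ.*-congˡ (ℂₛ.sym (ℂₛ.*-assoc _ _ _)))

basisKet : ∀ {n} → Basis n → Ket n
basisKet b c = 𝟙 c b

-- Being expectations, the diagonal entries of a positive operator are nonnegative reals;
-- `tr-nonNegReal` sums them.
expectation-basisKet : ∀ {n} (A : Operator n) b → ⟨ basisKet b ∣ A ∣ basisKet b ⟩ ≃ A b b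
expectation-basisKet A b = begin
  ⟨ basisKet b ∣ A ∣ basisKet b ⟩                          ≈⟨ ∑-only b _ (λ d d≢b → ∑-zero _ λ c → off d c d≢b) ⟩
  (∑ λ c → conj (𝟙 b b) *ᶜ (A b c *ᶜ 𝟙 c b))              ≈⟨ ∑-only b _ (λ c c≢b → off′ c c≢b) ⟩
  conj (𝟙 b b) *ᶜ (A b b *ᶜ 𝟙 b b)                        ≡⟨ cong (λ z → conj z *ᶜ (A b b *ᶜ z)) (𝟙-diagonal {b = b} refl) ⟩
  conj 1ᶜ *ᶜ (A b b *ᶜ 1ᶜ)                                ≈⟨ ℂₛ.*-cong conj-1 (ℂₛ.*-identityʳ (A b b)) ⟩
  1ᶜ *ᶜ A b b                                             ≈⟨ ℂₛ.*-identityˡ (A b b) ⟩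
  A b b                                                   ∎
  where
  off : ∀ d c → d ≢ b → conj (𝟙 d b) *ᶜ (A d c *ᶜ 𝟙 c b) ≃ 0ᶜ
  off d c d≢b rewrite 𝟙-off-diagonal d≢b = ℂₛ.trans (ℂₛ.*-congʳ conj-0) (ℂₛ.zeroˡ _)
  off′ : ∀ c → c ≢ b → conj (𝟙 b b) *ᶜ (A b c *ᶜ 𝟙 c b) ≃ 0ᶜ
  off′ c c≢b rewrite 𝟙-off-diagonal c≢b = ℂₛ.trans (ℂₛ.*-congˡ (ℂₛ.zeroʳ _)) (ℂₛ.zeroʳ _)

tr-cong : ∀ {n} (A B : Operator n) → A ≈ₒ B → tr A ≃ tr B
tr-cong A B A≈B = ∑-cong _ λ b → entrywise (A≈B b b)

tr-∑ₒ : ∀ {k n} (A : Fin k → Operator n) → tr (∑ₒ A) ≃ (sum λ i → tr (A i))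
tr-∑ₒ A = ℂₛ.sym (∑-sum-comm _ _ λ i b → A i b b)

tr-• : ∀ {n} p (A : Operator n) → tr (p • A) ≃ (p +i 0ᵣ) *ᶜ tr A
tr-• {n} p A = ℂₛ.sym (∑-*ˡ n _ _)

tr-comm : ∀ {n} (A B : Operator n) → tr (A ∙ B) ≃ tr (B ∙ A)
tr-comm A B = ℂₛ.trans (∑-comm _ _ λ b d → A b d *ᶜ B d b) (∑-cong _ λ d → ∑-cong _ λ b → ℂₛ.*-comm (A b d) (B d b))

tr-𝟙∙ : ∀ {n} {A : Operator n} → (∀ b c → A b c ≃ 𝟙 b c) → ∀ ρ → tr (A ∙ ρ) ≃ tr ρ
tr-𝟙∙ {A = A} A≃𝟙 ρ = ∑-cong _ λ b → begin
  (∑ λ d → A b d *ᶜ ρ d b)    ≈⟨ ∑-cong _ (λ d → ℂₛ.*-congʳ (A≃𝟙 b d)) ⟩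
  (∑ λ d → 𝟙 b d *ᶜ ρ d b)    ≈⟨ ∑-only b _ (λ d d≢b → ℂₛ.trans (ℂₛ.*-congʳ (ℂₛ.reflexive (𝟙-off-diagonal (d≢b ∘ sym)))) (ℂₛ.zeroˡ _)) ⟩
  𝟙 b b *ᶜ ρ b b              ≡⟨ cong (_*ᶜ ρ b b) (𝟙-diagonal {b = b} refl) ⟩
  1ᶜ *ᶜ ρ b b                 ≈⟨ ℂₛ.*-identityˡ (ρ b b) ⟩
  ρ b b                       ∎

-- Cyclicity of the trace brings each K† to the front, next to its K; by linearity the sum of the K†
-- K can then be formed inside a single trace.
tr-conjugates : ∀ {k n} (K : Fin k → Operator n) → (∀ b c → ∑ₒ (λ i → K i † ∙ K i) b c ≃ 𝟙 b c) →
                ∀ ρ → (sum λ i → tr (K i ∙ ρ ∙ K i †)) ≃ tr ρ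
tr-conjugates K complete ρ = begin
  (sum λ i → tr (K i ∙ ρ ∙ K i †))                            ≈⟨ sum-cong-≋ (λ i → ℂₛ.trans (tr-comm (K i ∙ ρ) (K i †)) (∑-cong _ λ b → ℂₛ.sym (∙-assoc (K i †) (K i) ρ b b))) ⟩
  (sum λ i → tr (K i † ∙ K i ∙ ρ))                            ≈⟨ tr-∑ₒ (λ i → K i † ∙ K i ∙ ρ) ⟨
  (∑ λ b → sum λ i → ∑ λ d → (K i † ∙ K i) b d *ᶜ ρ d b)      ≈⟨ ∑-cong _ (λ b → ∑-sum-comm _ _ λ i d → (K i † ∙ K i) b d *ᶜ ρ d b) ⟩
  (∑ λ b → ∑ λ d → sum λ i → (K i † ∙ K i) b d *ᶜ ρ d b)      ≈⟨ ∑-cong _ (λ b → ∑-cong _ λ d → *-distribʳ-sum (ρ d b) (λ i → (K i † ∙ K i) b d)) ⟨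
  tr (∑ₒ (λ i → K i † ∙ K i) ∙ ρ)                             ≈⟨ tr-𝟙∙ complete ρ ⟩
  tr ρ                                                        ∎

-- Operators acting at chosen positions of the register

-- A wrapper around the proposition decided by `agreeOff?`, so that `pos`, `b` and `c` can be
-- inferred from a proof of it.
record AgreeOff {k n} (pos : Vec (Fin n) k) (b c : Basis n) : Set where
  constructor agree
  field
    off : ∀ i → i ∈ᵥ pos ⊎ lookup b i ≡ lookup c i
open AgreeOff

agreeOff?′ : ∀ {k n} (pos : Vec (Fin n) k) b c → Dec (AgreeOff pos b c)
agreeOff?′ pos b c = map′ agree off (agreeOff? pos b c)

restrict : ∀ {k n} → Vec (Fin n) k → Basis n → Basis k
restrict pos b = Vec.map (lookup b) pos

agreeOff-sym : ∀ {k n} {pos : Vec (Fin n) k} {b c} → AgreeOff pos b c → AgreeOff pos c b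
agreeOff-sym b~c = agree λ i → Sum.map₂ sym (off b~c i)

agreeOff-refl : ∀ {k n} {pos : Vec (Fin n) k} {b} → AgreeOff pos b b
agreeOff-refl = agree λ _ → inj₂ refl

agreeOff-trans : ∀ {k n} {pos : Vec (Fin n) k} {b c d} → AgreeOff pos b c → AgreeOff pos c d → AgreeOff pos b d
agreeOff-trans b~c c~d = agree λ i →
  Sum.[ inj₁ , (λ bᵢ≡cᵢ → Sum.map₂ (trans bᵢ≡cᵢ) (off c~d i)) ] (off b~c i)

lookup-restrict : ∀ {k n} (pos : Vec (Fin n) k) {b c} → restrict pos b ≡ restrict pos c →
                  ∀ {i} → i ∈ᵥ pos → lookup b i ≡ lookup c i
lookup-restrict (_ ∷ _)           b≡c (here refl)   = Vecₚ.∷-injectiveˡ b≡c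
lookup-restrict (_ ∷ pos) {b} {c} b≡c (there i∈pos) = lookup-restrict pos {b} {c} (Vecₚ.∷-injectiveʳ b≡c) i∈pos

lookup-ext : ∀ {n} {b c : Basis n} → (∀ i → lookup b i ≡ lookup c i) → b ≡ c
lookup-ext {b = b} {c} h =
  trans (sym (Vecₚ.tabulate∘lookup b)) (trans (Vecₚ.tabulate-cong h) (Vecₚ.tabulate∘lookup c))

agreeOff-restrict : ∀ {k n} {pos : Vec (Fin n) k} {b c} →
                    AgreeOff pos b c → restrict pos b ≡ restrict pos c → b ≡ c
agreeOff-restrict {pos = pos} {b} {c} b~c b≡c =
  lookup-ext λ i → Sum.[ lookup-restrict pos {b} {c} b≡c , id ] (off b~c i)

agreeOff-update⁻ : ∀ {k n p} {ps : Vec (Fin n) k} {b d x} →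
                   AgreeOff ps d (b [ p ]≔ x) → AgreeOff (p ∷ ps) d b
agreeOff-update⁻ {p = p} {ps} {b} {d} {x} d~b = agree λ i → go i
  where
  go : ∀ i → i ∈ᵥ p ∷ ps ⊎ lookup d i ≡ lookup b i
  go i with i Finₚ.≟ p | off d~b i
  ... | yes refl | _          = inj₁ (here refl)
  ... | no  i≢p  | inj₁ i∈ps  = inj₁ (there i∈ps)
  ... | no  i≢p  | inj₂ dᵢ≡bᵢ = inj₂ (trans dᵢ≡bᵢ (Vecₚ.lookup∘update′ i≢p b x))

agreeOff-update⁺ : ∀ {k n p} {ps : Vec (Fin n) k} {b d} →
                   AgreeOff (p ∷ ps) d b → AgreeOff ps d (b [ p ]≔ lookup d p)
agreeOff-update⁺ {p = p} {ps} {b} {d} d~b = agree λ i → go i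
  where
  go : ∀ i → i ∈ᵥ ps ⊎ lookup d i ≡ lookup (b [ p ]≔ lookup d p) i
  go i with i Finₚ.≟ p | off d~b i
  ... | yes refl | _                   = inj₂ (sym (Vecₚ.lookup∘update p b _))
  ... | no  i≢p  | inj₁ (here i≡p)     = contradiction i≡p i≢p
  ... | no  i≢p  | inj₁ (there i∈ps)   = inj₁ i∈ps
  ... | no  i≢p  | inj₂ dᵢ≡bᵢ          = inj₂ (trans dᵢ≡bᵢ (sym (Vecₚ.lookup∘update′ i≢p b _)))

-- Distinctness of positions enters here: `p` is not among `ps`, so agreement off `ps` includes the
-- updated bit.
agreeOff-update-lookup : ∀ {k n p} {ps : Vec (Fin n) k} {b d x} → ¬ p ∈ᵥ ps →
                         AgreeOff ps d (b [ p ]≔ x) → lookup d p ≡ x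
agreeOff-update-lookup {p = p} {b = b} {x = x} p∉ps d~b with off d~b p
... | inj₁ p∈ps  = contradiction p∈ps p∉ps
... | inj₂ dₚ≡bₚ = trans dₚ≡bₚ (Vecₚ.lookup∘update p b x)

-- A basis vector agreeing with b off pos is determined by its restriction to
-- pos, one position of pos at a time.
∑-agreeOff : ∀ {k n} (pos : Vec (Fin n) k) → Uniqueᵥ pos → (b : Basis n) (g : Basis k → ℂ) →
             (∑ λ d → if does (agreeOff? pos d b) then g (restrict pos d) else 0ᶜ) ≃ ∑ g
∑-agreeOff [] [] b g = ℂₛ.trans
  (∑-only b _ λ d d≢b → ℂₛ.reflexive (if-false (agreeOff? [] d b) λ d~b → d≢b (agreeOff-restrict (agree d~b) refl)))
  (ℂₛ.reflexive (if-true (agreeOff? [] b b) λ _ → inj₂ refl))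
∑-agreeOff {n = n} (p ∷ ps) (p≢ps ∷ ps!) b g = begin
  ∑ (whole (p ∷ ps) b g)                       ≈⟨ ∑-cong n (λ d → split d (lookup d p) refl) ⟩
  (∑ λ d → branch false d +ᶜ branch true d)    ≈⟨ ∑-distrib-+ n (branch false) (branch true) ⟩
  ∑ (branch false) +ᶜ ∑ (branch true)          ≈⟨ ℂₛ.+-cong (∑-agreeOff ps ps! (b [ p ]≔ false) (g ∘ (false ∷_))) (∑-agreeOff ps ps! (b [ p ]≔ true) (g ∘ (true ∷_))) ⟩
  ∑ g                                          ∎
  where
  whole : ∀ {k} (pos : Vec (Fin n) k) → Basis n → (Basis k → ℂ) → Basis n → ℂ
  whole pos b g d = if does (agreeOff? pos d b) then g (restrict pos d) else 0ᶜ
  -- The vectors `d` whose bit at `p` is `x`: writing `x` into `b` at `p` reduces agreement off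
  -- `p ∷ ps` to agreement off `ps`. Every `d` contributes to exactly one branch, and the two
  -- branches are the two halves into which `∑ g` unfolds.
  branch : Bool → Basis n → ℂ
  branch x = whole ps (b [ p ]≔ x) (g ∘ (x ∷_))
  p∉ps : ¬ p ∈ᵥ ps
  p∉ps p∈ps = VecAll.lookup p≢ps p∈ps refl
  same : ∀ d x → lookup d p ≡ x → branch x d ≡ whole (p ∷ ps) b g d
  same d x refl = cong (if_then g (restrict (p ∷ ps) d) else 0ᶜ)
    (does-⇔ (mk⇔ (λ d~b → off (agreeOff-update⁻ {b = b} (agree {b = d} d~b))) (λ d~b → off (agreeOff-update⁺ (agree {b = d} {b} d~b)))) (agreeOff? ps d (b [ p ]≔ x)) (agreeOff? (p ∷ ps) d b))
  other : ∀ d x → lookup d p ≢ x → branch x d ≡ 0ᶜ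
  other d x dₚ≢x = if-false (agreeOff? ps d (b [ p ]≔ x)) λ d~b → dₚ≢x (agreeOff-update-lookup {b = b} p∉ps (agree {b = d} d~b))
  split : ∀ d x → lookup d p ≡ x → whole (p ∷ ps) b g d ≃ branch false d +ᶜ branch true d
  split d false dₚ≡x = ℂₛ.sym (ℂₛ.trans
    (ℂₛ.+-cong (ℂₛ.reflexive (same d false dₚ≡x)) (ℂₛ.reflexive (other d true λ dₚ≡y → contradiction (trans (sym dₚ≡x) dₚ≡y) λ ())))
    (ℂₛ.+-identityʳ _))
  split d true  dₚ≡x = ℂₛ.sym (ℂₛ.trans
    (ℂₛ.+-cong (ℂₛ.reflexive (other d false λ dₚ≡y → contradiction (trans (sym dₚ≡x) dₚ≡y) λ ())) (ℂₛ.reflexive (same d true dₚ≡x)))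
    (ℂₛ.+-identityˡ _))

at-yes : ∀ {k n} (K : Operator k) (pos : Vec (Fin n) k) {b c} → AgreeOff pos b c →
         (K at pos) b c ≡ K (restrict pos b) (restrict pos c)
at-yes K pos {b} {c} b~c = if-true (agreeOff? pos b c) (off b~c)

at-no : ∀ {k n} (K : Operator k) (pos : Vec (Fin n) k) {b c} → ¬ AgreeOff pos b c → (K at pos) b c ≡ 0ᶜ
at-no K pos {b} {c} b≁c = if-false (agreeOff? pos b c) (b≁c ∘ agree)

-- If `b` and `c` differ somewhere off `pos`, no intermediate `d` agrees with both, and every term
-- vanishes. Otherwise the sum over `d` collapses by `∑-agreeOff` to the completeness relation of
-- `ℰ` at the two restrictions, and vectors that agree off `pos` are equal exactly if their
-- restrictions are.
complete-at : ∀ {k n} (ℰ : KrausFamily k) (pos : Vec (Fin n) k) → Uniqueᵥ pos → ∀ b c →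
              ∑ₒ (λ i → (kraus ℰ i at pos) † ∙ (kraus ℰ i at pos)) b c ≃ 𝟙 b c
complete-at {k} {n} ℰ pos pos! b c with agreeOff?′ pos b c
... | no b≁c = begin
  (sum λ i → ∑ λ d → conj ((kraus ℰ i at pos) d b) *ᶜ (kraus ℰ i at pos) d c)    ≈⟨ sum-cong-≋ (λ i → ∑-zero n λ d → vanish i d (agreeOff?′ pos d b)) ⟩
  (sum {size ℰ} λ i → 0ᶜ)                                                       ≈⟨ sum-replicate-zero (size ℰ) ⟩
  0ᶜ                                                                            ≡⟨ 𝟙-off-diagonal {b = b} {c} (λ { refl → b≁c agreeOff-refl }) ⟨
  𝟙 b c                                                                         ∎
  where
  vanish : ∀ i d → Dec (AgreeOff pos d b) → conj ((kraus ℰ i at pos) d b) *ᶜ (kraus ℰ i at pos) d c ≃ 0ᶜ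
  vanish i d (no d≁b)  = ℂₛ.trans
    (ℂₛ.*-congʳ (ℂₛ.trans (ℂₛ.reflexive (cong conj (at-no (kraus ℰ i) pos d≁b))) conj-0)) (ℂₛ.zeroˡ _)
  vanish i d (yes d~b) = ℂₛ.trans
    (ℂₛ.*-congˡ (ℂₛ.reflexive (at-no (kraus ℰ i) pos λ d~c → b≁c (agreeOff-trans (agreeOff-sym d~b) d~c)))) (ℂₛ.zeroʳ _)
... | yes b~c = begin
  (sum λ i → ∑ λ d → conj ((kraus ℰ i at pos) d b) *ᶜ (kraus ℰ i at pos) d c)    ≈⟨ sum-cong-≋ (λ i → ∑-cong n λ d → local i d (agreeOff?′ pos d b)) ⟩
  (sum λ i → ∑ λ d → if does (agreeOff? pos d b) then entry i (restrict pos d) else 0ᶜ)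
                                                                                ≈⟨ sum-cong-≋ (λ i → ∑-agreeOff pos pos! b (entry i)) ⟩
  (sum λ i → ∑ (entry i))                                                       ≈⟨ entrywise (complete ℰ (restrict pos b) (restrict pos c)) ⟩
  𝟙 (restrict pos b) (restrict pos c)                                           ≡⟨ diagonal (Vecₚ.≡-dec Boolₚ._≟_ b c) ⟩
  𝟙 b c                                                                         ∎
  where
  entry : Fin (size ℰ) → Basis k → ℂ
  entry i e = conj (kraus ℰ i e (restrict pos b)) *ᶜ kraus ℰ i e (restrict pos c)
  local : ∀ i d (d~?b : Dec (AgreeOff pos d b)) →
          conj ((kraus ℰ i at pos) d b) *ᶜ (kraus ℰ i at pos) d c ≃
          (if does (agreeOff? pos d b) then entry i (restrict pos d) else 0ᶜ)
  local i d (no d≁b)  = ℂₛ.trans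
    (ℂₛ.trans (ℂₛ.*-congʳ (ℂₛ.trans (ℂₛ.reflexive (cong conj (at-no (kraus ℰ i) pos d≁b))) conj-0)) (ℂₛ.zeroˡ _))
    (ℂₛ.reflexive (sym (if-false (agreeOff? pos d b) (d≁b ∘ agree))))
  local i d (yes d~b) = ℂₛ.reflexive (trans
    (cong₂ (λ x y → conj x *ᶜ y) (at-yes (kraus ℰ i) pos d~b) (at-yes (kraus ℰ i) pos (agreeOff-trans d~b b~c)))
    (sym (if-true (agreeOff? pos d b) (off d~b))))
  diagonal : Dec (b ≡ c) → 𝟙 (restrict pos b) (restrict pos c) ≡ 𝟙 b c
  diagonal (yes b≡c) = trans (𝟙-diagonal (cong (restrict pos) b≡c)) (sym (𝟙-diagonal {b = b} b≡c))
  diagonal (no b≢c)  = trans (𝟙-off-diagonal (b≢c ∘ agreeOff-restrict b~c)) (sym (𝟙-off-diagonal {b = b} b≢c))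

-- Positivity and density operators

0≤1 : 0ᵣ ≤ᵣ 1ᵣ
0≤1 = mk≤ λ ε 0<ε → 0 , λ _ _ → ℚₚ.<-trans 0<ε (ℚₚ.≤-<-trans (ℚₚ.≤-reflexive (sym (ℚₚ.+-identityˡ ε))) (ℚₚ.+-monoˡ-< ε (ℚₚ.positive⁻¹ 1ℚ)))

0+0≈0 : 0ᵣ +ᵣ 0ᵣ ≈ᵣ 0ᵣ
0+0≈0 = ≗⇒≈ λ _ → refl

0≤-resp-≈ : ∀ {x y} → x ≈ᵣ y → 0ᵣ ≤ᵣ x → 0ᵣ ≤ᵣ y
0≤-resp-≈ x≈y 0≤x = ≤-trans 0≤x (≈⇒≤ x≈y)

0≤⁻⇒≤0 : ∀ {x} → 0ᵣ ≤ᵣ -ᵣ x → x ≤ᵣ 0ᵣ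
0≤⁻⇒≤0 {x} 0≤-x = ≤-trans (≈⇒≤ (≈-sym (neg-neg x))) (≤-trans (neg-antimono-≤ 0≤-x) (≈⇒≤ (≗⇒≈ λ _ → refl)))
  where
  neg-neg : ∀ x → -ᵣ -ᵣ x ≈ᵣ x
  neg-neg (real x _) = ≗⇒≈ λ n → solve 1 (λ x → :- (:- x) := x) refl (x n)

-- The cancellation of `p` in inequalities, applied to x and to -x.
p*x≈0⇒x≈0 : ∀ {p x} → 0ᵣ ≤ᵣ p → ¬ p ≈ᵣ 0ᵣ → p *ᵣ x ≈ᵣ 0ᵣ → x ≈ᵣ 0ᵣ
p*x≈0⇒x≈0 {p} {x} 0≤p p≉0 px≈0 = ≤-antisym
  (0≤⁻⇒≤0 (0≤p*x⇒0≤x 0≤p p≉0 (≈⇒≤ (≈-trans (≗⇒≈ λ _ → refl) (≈-trans (≈-sym (neg-cong px≈0)) (neg-* p x))))))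
  (0≤p*x⇒0≤x 0≤p p≉0 (≈⇒≤ (≈-sym px≈0)))
  where
  neg-* : ∀ p x → -ᵣ (p *ᵣ x) ≈ᵣ p *ᵣ (-ᵣ x)
  neg-* (real p _) (real x _) = ≗⇒≈ λ n → ℚₚ.neg-distribʳ-* (p n) (x n)

-- Here `p` is cancelled from p (x - 1) = p x - p ≈ 0.
p*x≈p⇒x≈1 : ∀ {p x} → 0ᵣ ≤ᵣ p → ¬ p ≈ᵣ 0ᵣ → p *ᵣ x ≈ᵣ p → x ≈ᵣ 1ᵣ
p*x≈p⇒x≈1 {p} {x} 0≤p p≉0 px≈p = ≈-trans (cancel x)
  (≈-trans (+-cong (p*x≈0⇒x≈0 0≤p p≉0 (≈-trans (distrib p x) (≈-trans (+-cong px≈p ≈-refl) (inverse p)))) ≈-refl) (≗⇒≈ λ _ → refl))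
  where
  cancel : ∀ x → x ≈ᵣ x +ᵣ -ᵣ 1ᵣ +ᵣ 1ᵣ
  cancel (real x _) = ≗⇒≈ λ n → solve 1 (λ x → x := x :+ (:- con 1ℚ) :+ con 1ℚ) refl (x n)
  distrib : ∀ p x → p *ᵣ (x +ᵣ -ᵣ 1ᵣ) ≈ᵣ p *ᵣ x +ᵣ -ᵣ p
  distrib (real p _) (real x _) = ≗⇒≈ λ n → solve 2 (λ p x → p :* (x :+ (:- con 1ℚ)) := p :* x :+ (:- p)) refl (p n) (x n)
  inverse : ∀ p → p +ᵣ -ᵣ p ≈ᵣ 0ᵣ
  inverse (real p _) = ≗⇒≈ λ n → ℚₚ.+-inverseʳ (p n)

-- IsPositive says that every ⟨ v ∣ A ∣ v ⟩ is such a number.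
record NonNegReal (z : ℂ) : Set where
  constructor nonNegReal
  field
    0≤re : 0ᵣ ≤ᵣ re z
    im≈0 : im z ≈ᵣ 0ᵣ
open NonNegReal

nonNegReal-resp : ∀ {z w} → z ≃ w → NonNegReal z → NonNegReal w
nonNegReal-resp z≃w (nonNegReal p q) =
  nonNegReal (0≤-resp-≈ (re-cong z≃w) p) (≈-trans (≈-sym (im-cong z≃w)) q)

nonNegReal-0 : NonNegReal 0ᶜ
nonNegReal-0 = nonNegReal ≤-refl ≈-refl

nonNegReal-+ : ∀ {z w} → NonNegReal z → NonNegReal w → NonNegReal (z +ᶜ w)
nonNegReal-+ {_ +i _} {_ +i _} (nonNegReal p q) (nonNegReal r s) = nonNegReal
  (≤-trans (≈⇒≤ (≈-sym 0+0≈0)) (+-mono-≤ p r)) (≈-trans (+-cong q s) 0+0≈0)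

nonNegReal-sum : ∀ {k} {f : Fin k → ℂ} → (∀ i → NonNegReal (f i)) → NonNegReal (sum f)
nonNegReal-sum {ℕ.zero}  h = nonNegReal-0
nonNegReal-sum {ℕ.suc k} h = nonNegReal-+ (h zero) (nonNegReal-sum (h ∘ suc))

nonNegReal-∑ : ∀ n {f : Basis n → ℂ} → (∀ b → NonNegReal (f b)) → NonNegReal (∑ f)
nonNegReal-∑ ℕ.zero    h = h []
nonNegReal-∑ (ℕ.suc n) h = nonNegReal-+ (nonNegReal-∑ n (h ∘ (_ ∷_))) (nonNegReal-∑ n (h ∘ (_ ∷_)))

nonNegReal-unscale : ∀ {p z} → 0ᵣ ≤ᵣ p → ¬ p ≈ᵣ 0ᵣ → NonNegReal ((p +i 0ᵣ) *ᶜ z) → NonNegReal z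
nonNegReal-unscale {p} {z} 0≤p p≉0 (nonNegReal q r) = nonNegReal
  (0≤p*x⇒0≤x 0≤p p≉0 (0≤-resp-≈ (re-scale p z) q))
  (p*x≈0⇒x≈0 0≤p p≉0 (≈-trans (≈-sym (im-scale p z)) r))

expectation : ∀ {n} {A : Operator n} → IsPositive A → ∀ v → NonNegReal ⟨ v ∣ A ∣ v ⟩
expectation A≥0 v = nonNegReal (IsPositive.nonNegative A≥0 v) (IsPositive.real-valued A≥0 v)

isPositive : ∀ {n} {A : Operator n} → (∀ v → NonNegReal ⟨ v ∣ A ∣ v ⟩) → IsPositive A
isPositive h = record { real-valued = im≈0 ∘ h ; nonNegative = 0≤re ∘ h }

isPositive-resp-≈ₒ : ∀ {n} {A B : Operator n} → A ≈ₒ B → IsPositive A → IsPositive B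
isPositive-resp-≈ₒ A≈B A≥0 = isPositive λ v → nonNegReal-resp (expectation-cong A≈B v v) (expectation A≥0 v)

isDensity-resp-≈ₒ : ∀ {n} {A B : Operator n} → A ≈ₒ B → IsDensity A → IsDensity B
isDensity-resp-≈ₒ {A = A} {B} A≈B A-density = record
  { positive   = isPositive-resp-≈ₒ A≈B (IsDensity.positive A-density)
  ; unit-trace = _≃_.parts (ℂₛ.trans (ℂₛ.sym (tr-cong A B A≈B)) (entrywise {z = tr A} {w = 1ᶜ} (IsDensity.unit-trace A-density)))
  }

tr-nonNegReal : ∀ {n} {A : Operator n} → IsPositive A → NonNegReal (tr A)
tr-nonNegReal {n} {A} A≥0 =
  nonNegReal-∑ n λ b → nonNegReal-resp (expectation-basisKet A b) (expectation A≥0 (basisKet b))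

conjugate-isPositive : ∀ {k n} (K : Operator k) (pos : Vec (Fin n) k) {ρ} → IsPositive ρ → IsPositive (conjugate K pos ρ)
conjugate-isPositive K pos {ρ} ρ≥0 = isPositive λ v →
  nonNegReal-resp (ℂₛ.sym (expectation-conjugate (K at pos) ρ v)) (expectation ρ≥0 ((K at pos) † · v))

∑ₒ-isPositive : ∀ {k n} {A : Fin k → Operator n} → (∀ i → IsPositive (A i)) → IsPositive (∑ₒ A)
∑ₒ-isPositive {A = A} A≥0 = isPositive λ v →
  nonNegReal-resp (ℂₛ.sym (expectation-∑ₒ A v v)) (nonNegReal-sum λ i → expectation (A≥0 i) v)

∑-tr-conjugate : ∀ {k n} (ℰ : KrausFamily k) (pos : Vec (Fin n) k) → Uniqueᵥ pos → ∀ {ρ} → IsDensity ρ →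
                 (sum λ i → tr (conjugate (kraus ℰ i) pos ρ)) ≃ 1ᶜ
∑-tr-conjugate ℰ pos pos! {ρ} ρ-density = ℂₛ.trans
  (tr-conjugates (λ i → kraus ℰ i at pos) (complete-at ℰ pos pos!) ρ) (entrywise (IsDensity.unit-trace ρ-density))

applyAt-isDensity : ∀ {k n} (ℰ : Superoperator k) (pos : Vec (Fin n) k) → Uniqueᵥ pos →
                    ∀ {ρ} → IsDensity ρ → IsDensity (applyAt ℰ pos ρ)
applyAt-isDensity ℰ pos pos! {ρ} ρ-density = record
  { positive   = ∑ₒ-isPositive λ i → conjugate-isPositive (kraus ℰ i) pos (IsDensity.positive ρ-density)
  ; unit-trace = _≃_.parts (ℂₛ.trans (tr-∑ₒ λ i → conjugate (kraus ℰ i) pos ρ) (∑-tr-conjugate ℰ pos pos! ρ-density))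
  }

-- Expectations and trace of σ, multiplied by p, are those of A. As tr A is real with real part p,
-- cancelling p leaves 1 as the real part of tr σ and 0 as its imaginary part.
normalise-isDensity : ∀ {n} {A σ : Operator n} → IsPositive A → let p = re (tr A) in
                      ¬ p ≈ᵣ 0ᵣ → p • σ ≈ₒ A → IsDensity σ
normalise-isDensity {A = A} {σ} A≥0 p≉0 pσ≈A = record
  { positive   = isPositive λ v → nonNegReal-unscale 0≤p p≉0
      (nonNegReal-resp (ℂₛ.trans (ℂₛ.sym (expectation-cong pσ≈A v v)) (expectation-• p σ v v)) (expectation A≥0 v))
  ; unit-trace =
      p*x≈p⇒x≈1 0≤p p≉0 (≈-trans (≈-sym (re-scale p (tr σ))) (re-cong p*trσ≃trA)) ,
      p*x≈0⇒x≈0 0≤p p≉0 (≈-trans (≈-sym (im-scale p (tr σ))) (≈-trans (im-cong p*trσ≃trA) (im≈0 (tr-nonNegReal A≥0))))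
  }
  where
  p : ℝ
  p = re (tr A)
  0≤p : 0ᵣ ≤ᵣ p
  0≤p = 0≤re (tr-nonNegReal A≥0)
  p*trσ≃trA : (p +i 0ᵣ) *ᶜ tr σ ≃ tr A
  p*trσ≃trA = ℂₛ.trans (ℂₛ.sym (tr-• p σ)) (tr-cong (p • σ) A pσ≈A)

re-sum : ∀ {k} (f : Fin k → ℂ) → re (sum f) ≡ List.foldr _+ᵣ_ 0ᵣ (List.tabulate (re ∘ f))
re-sum {ℕ.zero}  f = refl
re-sum {ℕ.suc k} f = trans (re-+ (f zero) _) (cong (re (f zero) +ᵣ_) (re-sum (f ∘ suc)))

-- Typing of processes

private variable
  m n : ℕ
  T U : Ty
  Γ Ξ : Ctx n
  Σ Σ′ Σ₁ Σ₂ : NameSet n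
  e : Expr n
  v : Value
  P Q : Proc n

↑-mono : Σ ⊆ Σ′ → ∀ b → (↑ Σ) b → (↑ Σ′) b
↑-mono Σ⊆Σ′ (qubit q)     = Σ⊆Σ′
↑-mono Σ⊆Σ′ (var (suc x)) = Σ⊆Σ′

↑-cong : Σ ≐ Σ′ → ↑ Σ ≐ ↑ Σ′
↑-cong (Σ⊆Σ′ , Σ′⊆Σ) = (λ {b} → ↑-mono Σ⊆Σ′ b) , (λ {b} → ↑-mono Σ′⊆Σ b)

∪-cong : {A A′ B B′ : NameSet n} → A ≐ A′ → B ≐ B′ → A ∪ B ≐ A′ ∪ B′
∪-cong (p , q) (r , s) = Sum.map p r , Sum.map q s

wk : Name n → Name (ℕ.suc n)
wk (qubit q) = qubit q
wk (var x)   = var (suc x)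

⌜wk⌝ : ∀ (a : Name n) → ⌜ wk a ⌝ ≡ weaken ⌜ a ⌝
⌜wk⌝ (qubit _) = refl
⌜wk⌝ (var _)   = refl

wk-injective : ∀ {a b : Name n} → wk a ≡ wk b → a ≡ b
wk-injective {a = qubit _} {qubit _} refl = refl
wk-injective {a = var _}   {var _}   refl = refl

wk-∈⁺ : ∀ (a : Name n) → Σ a → (↑ Σ) (wk a)
wk-∈⁺ (qubit _) = id
wk-∈⁺ (var _)   = id

wk-∈⁻ : ∀ (a : Name n) → (↑ Σ) (wk a) → Σ a
wk-∈⁻ (qubit _) = id
wk-∈⁻ (var _)   = id

∈-↑ : ∀ (b : Name (ℕ.suc n)) → (↑ Σ) b → ∃[ a ] Σ a × b ≡ wk a
∈-↑ (qubit q)     b∈ = qubit q , b∈ , refl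
∈-↑ (var (suc x)) b∈ = var x , b∈ , refl

wk≢zero : ∀ (a : Name n) → wk a ≢ var zero
wk≢zero (qubit _) ()
wk≢zero (var _)   ()

⌜⌝-injective : ∀ {a b : Name n} → ⌜ a ⌝ ≡ ⌜ b ⌝ → a ≡ b
⌜⌝-injective {a = qubit _} {qubit _} refl = refl
⌜⌝-injective {a = var _}   {var _}   refl = refl

⊢-resp-≐ : Σ ≐ Σ′ → Γ ⨾ Σ ⊢ P → Γ ⨾ Σ′ ⊢ P
⊢-resp-≐ Σ≐ (discard as as∶ as! Σ≐as es≡)    = discard as as∶ as! (≐-trans (≐-sym Σ≐) Σ≐as) es≡
⊢-resp-≐ Σ≐ (τ∙ P)                           = τ∙ ⊢-resp-≐ Σ≐ P
⊢-resp-≐ Σ≐ (apply as as! as∈ es≡ P)         = apply as as! (VecAll.map (proj₁ Σ≐) as∈) es≡ (⊢-resp-≐ Σ≐ P)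
⊢-resp-≐ Σ≐ (measure as as! as∈ es≡ P)       = measure as as! (VecAll.map (proj₁ Σ≐) as∈) es≡ (⊢-resp-≐ (↑-cong Σ≐) P)
⊢-resp-≐ Σ≐ (recvᶜ c≢ P)                     = recvᶜ c≢ (⊢-resp-≐ (↑-cong Σ≐) P)
⊢-resp-≐ Σ≐ (recvᵠ c≡ P)                     = recvᵠ c≡ (⊢-resp-≐ (∪-cong (↑-cong Σ≐) ≐-refl) P)
⊢-resp-≐ Σ≐ (sendᶜ c≢ e Σ≐∅)                 = sendᶜ c≢ e (≐-trans (≐-sym Σ≐) Σ≐∅)
⊢-resp-≐ Σ≐ (sendᵠ a c≡ a∶ Σ≐a e≡)           = sendᵠ a c≡ a∶ (≐-trans (≐-sym Σ≐) Σ≐a) e≡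
⊢-resp-≐ Σ≐ (P ⊕ Q)                          = ⊢-resp-≐ Σ≐ P ⊕ ⊢-resp-≐ Σ≐ Q
⊢-resp-≐ Σ≐ (par Σ₁ Σ₂ Σ₁⊥Σ₂ Σ≐∪ P Q)        = par Σ₁ Σ₂ Σ₁⊥Σ₂ (≐-trans (≐-sym Σ≐) Σ≐∪) P Q
⊢-resp-≐ Σ≐ (res P)                          = res (⊢-resp-≐ Σ≐ P)
⊢-resp-≐ Σ≐ (ite e P Q)                      = ite e (⊢-resp-≐ Σ≐ P) (⊢-resp-≐ Σ≐ Q)

-- The leaves `discard` and output determine their sets outright, and all other rules compute theirs
-- from those of the subprocesses, so two derivations agree from the leaves up. Exchanging them
-- gives the converse inclusion.
⊢-⊆ : Γ ⨾ Σ ⊢ P → Γ ⨾ Σ′ ⊢ P → Σ ⊆ Σ′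
⊢-⊆ (discard as _ _ Σ≐as es≡) (discard bs _ _ Σ′≐bs es≡′) {a} a∈Σ =
  proj₂ Σ′≐bs (subst (_ ∈_) (Listₚ.map-injective ⌜⌝-injective (trans (sym es≡) es≡′)) (proj₁ Σ≐as a∈Σ))
⊢-⊆ (τ∙ P)               (τ∙ P′)               = ⊢-⊆ P P′
⊢-⊆ (apply _ _ _ _ P)    (apply _ _ _ _ P′)    = ⊢-⊆ P P′
⊢-⊆ (measure _ _ _ _ P)  (measure _ _ _ _ P′) {a} a∈Σ = wk-∈⁻ a (⊢-⊆ P P′ {wk a} (wk-∈⁺ a a∈Σ))
⊢-⊆ (recvᶜ _ P)          (recvᶜ _ P′)         {a} a∈Σ = wk-∈⁻ a (⊢-⊆ P P′ {wk a} (wk-∈⁺ a a∈Σ))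
⊢-⊆ (recvᶜ c≢ _)         (recvᵠ c≡ _)          = contradiction c≡ c≢
⊢-⊆ (recvᵠ c≡ _)         (recvᶜ c≢ _)          = contradiction c≡ c≢
-- A weakened name is never the new variable, so it must come from the part under `↑`.
⊢-⊆ (recvᵠ _ P)          (recvᵠ _ P′)         {a} a∈Σ with ⊢-⊆ P P′ (inj₁ (wk-∈⁺ a a∈Σ))
... | inj₁ a∈Σ′ = wk-∈⁻ a a∈Σ′
... | inj₂ zero≡a = contradiction (sym zero≡a) (wk≢zero a)
⊢-⊆ (sendᶜ _ _ Σ≐∅)      (sendᶜ _ _ _)         = ⊥-elim ∘ proj₁ Σ≐∅
⊢-⊆ (sendᶜ c≢ _ _)       (sendᵠ _ c≡ _ _ _)    = contradiction c≡ c≢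
⊢-⊆ (sendᵠ _ c≡ _ _ _)   (sendᶜ c≢ _ _)        = contradiction c≡ c≢
⊢-⊆ (sendᵠ a _ _ Σ≐a e≡) (sendᵠ b _ _ Σ′≐b e≡′) x∈Σ =
  proj₂ Σ′≐b (trans (⌜⌝-injective (trans (sym e≡′) e≡)) (proj₁ Σ≐a x∈Σ))
⊢-⊆ (P ⊕ _)              (P′ ⊕ _)              = ⊢-⊆ P P′
⊢-⊆ (par _ _ _ Σ≐∪ P Q)  (par _ _ _ Σ′≐∪ P′ Q′) =
  proj₂ Σ′≐∪ ∘ Sum.map (⊢-⊆ P P′) (⊢-⊆ Q Q′) ∘ proj₁ Σ≐∪
⊢-⊆ (res P)              (res P′)              = ⊢-⊆ P P′
⊢-⊆ (ite _ P _)          (ite _ P′ _)          = ⊢-⊆ P P′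

⊢-unique : Γ ⨾ Σ ⊢ P → Γ ⨾ Σ′ ⊢ P → Σ ≐ Σ′
⊢-unique P P′ = ⊢-⊆ P P′ , ⊢-⊆ P′ P

var-type : ∀ {x} → Γ ⊢ var x ∶ T → Vec.lookup Γ x ≡ T
var-type (var _) = refl

val-type : ∀ {v} → Γ ⊢ val v ∶ T → typeOf v ≡ T
val-type (val _) = refl

var-typed : ∀ {x} → Vec.lookup Γ x ≡ T → Γ ⊢ var x ∶ T
var-typed refl = var _

wk-typed⁻ : ∀ (a : Name n) → U ∷ Γ ⊢ ⌜ wk a ⌝ ∶ qubit → Γ ⊢ ⌜ a ⌝ ∶ qubit
wk-typed⁻ (qubit q) _ = val (qubit q)
wk-typed⁻ (var x)   t = var-typed (var-type t)

-- The rules for `apply` and `measure` record only that their arguments lie in Σ. The type of an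
-- argument, which `acts` asks for, is found where the continuation sends or discards it.
∈⇒qubit : Γ ⨾ Σ ⊢ P → ∀ {a} → Σ a → Γ ⊢ ⌜ a ⌝ ∶ qubit
∈⇒qubit (discard _ as∶ _ Σ≐as _) a∈Σ = All.lookup as∶ (proj₁ Σ≐as a∈Σ)
∈⇒qubit (τ∙ P)                       = ∈⇒qubit P
∈⇒qubit (apply _ _ _ _ P)            = ∈⇒qubit P
∈⇒qubit (measure _ _ _ _ P) {a}      = wk-typed⁻ a ∘ ∈⇒qubit P ∘ wk-∈⁺ a
∈⇒qubit (recvᶜ _ P)         {a}      = wk-typed⁻ a ∘ ∈⇒qubit P ∘ wk-∈⁺ a
∈⇒qubit (recvᵠ _ P)         {a}      = wk-typed⁻ a ∘ ∈⇒qubit P ∘ inj₁ ∘ wk-∈⁺ a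
∈⇒qubit (sendᶜ _ _ Σ≐∅)              = ⊥-elim ∘ proj₁ Σ≐∅
∈⇒qubit (sendᵠ _ _ a∶ Σ≐a _) x∈Σ     = subst (λ x → _ ⊢ ⌜ x ⌝ ∶ qubit) (proj₁ Σ≐a x∈Σ) a∶
∈⇒qubit (P ⊕ _)                      = ∈⇒qubit P
∈⇒qubit (par _ _ _ Σ≐∪ P Q)          = Sum.[ ∈⇒qubit P , ∈⇒qubit Q ] ∘ proj₁ Σ≐∪
∈⇒qubit (res P)                      = ∈⇒qubit P
∈⇒qubit (ite _ P _)                  = ∈⇒qubit P

unique-mapᵥ : ∀ {A B : Set} {S : A → Set} {f : A → B} → (∀ {a b} → S a → S b → f a ≡ f b → a ≡ b) →
              ∀ {k} {as : Vec A k} → Allᵥ S as → Uniqueᵥ as → Uniqueᵥ (Vec.map f as)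
unique-mapᵥ f-inj []        []          = []
unique-mapᵥ f-inj (a ∷ as∈) (a≢ ∷ as!) =
  VecAllₚ.map⁺ (VecAll.map (λ (b , a≢b) → a≢b ∘ f-inj a b) (VecAll.zip (as∈ , a≢))) ∷ unique-mapᵥ f-inj as∈ as!

unique-map : ∀ {A B : Set} {S : A → Set} {f : A → B} → (∀ {a b} → S a → S b → f a ≡ f b → a ≡ b) →
             ∀ {as : List A} → All S as → Unique as → Unique (List.map f as)
unique-map f-inj []        []          = []
unique-map f-inj (a ∷ as∈) (a≢ ∷ as!) =
  Allₚ.map⁺ (All.map (λ (b , a≢b) → a≢b ∘ f-inj a b) (All.zip (as∈ , a≢))) ∷ unique-map f-inj as∈ as!

-- Substitution as a renaming of names

Image : (Name m → Name n) → NameSet m → NameSet n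
Image ν Σ b = ∃[ a ] Σ a × ν a ≡ b

-- Relative to Σ because `instantiate` is not injective outright: it maps both `var zero` and the
-- qubit substituted for it to that qubit.
InjectiveOn : NameSet m → (Name m → Name n) → Set
InjectiveOn Σ ν = ∀ {a b} → Σ a → Σ b → ν a ≡ ν b → a ≡ b

liftⁿ : (Name m → Name n) → Name (ℕ.suc m) → Name (ℕ.suc n)
liftⁿ ν (qubit q)     = wk (ν (qubit q))
liftⁿ ν (var zero)    = var zero
liftⁿ ν (var (suc x)) = wk (ν (var x))

liftⁿ-wk : ∀ (ν : Name m → Name n) a → liftⁿ ν (wk a) ≡ wk (ν a)
liftⁿ-wk ν (qubit _) = refl
liftⁿ-wk ν (var _)   = refl

Image-cong : ∀ {ν : Name m → Name n} → Σ ≐ Σ′ → Image ν Σ ≐ Image ν Σ′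
Image-cong (Σ⊆Σ′ , Σ′⊆Σ) =
  (λ (a , a∈ , a≡) → a , Σ⊆Σ′ a∈ , a≡) , (λ (a , a∈ , a≡) → a , Σ′⊆Σ a∈ , a≡)

Image-∪ : ∀ {ν : Name m → Name n} → Image ν (Σ₁ ∪ Σ₂) ≐ Image ν Σ₁ ∪ Image ν Σ₂
Image-∪ =
  (λ { (a , inj₁ a∈ , a≡) → inj₁ (a , a∈ , a≡) ; (a , inj₂ a∈ , a≡) → inj₂ (a , a∈ , a≡) }) ,
  (λ { (inj₁ (a , a∈ , a≡)) → a , inj₁ a∈ , a≡ ; (inj₂ (a , a∈ , a≡)) → a , inj₂ a∈ , a≡ })

Image-｛｝ : ∀ {ν : Name m → Name n} {a} → Image ν ｛ a ｝ ≐ ｛ ν a ｝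
Image-｛｝ = (λ { (_ , refl , a≡) → a≡ }) , (λ a≡ → _ , refl , a≡)

Image-↑ : ∀ {ν : Name m → Name n} → Image (liftⁿ ν) (↑ Σ) ≐ ↑ Image ν Σ
Image-↑ {Σ = Σ} {ν} = to , from
  where
  to : Image (liftⁿ ν) (↑ Σ) ⊆ ↑ Image ν Σ
  to (b , b∈ , refl) with ∈-↑ b b∈
  ... | a , a∈ , refl rewrite liftⁿ-wk ν a = wk-∈⁺ (ν a) (a , a∈ , refl)
  from : ↑ Image ν Σ ⊆ Image (liftⁿ ν) (↑ Σ)
  from {b} b∈ with ∈-↑ b b∈
  ... | _ , (a , a∈ , refl) , refl = wk a , wk-∈⁺ a a∈ , liftⁿ-wk ν a

liftⁿ-injectiveOn : ∀ {ν : Name m → Name n} → InjectiveOn Σ ν → InjectiveOn (↑ Σ) (liftⁿ ν)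
liftⁿ-injectiveOn {ν = ν} ν-inj {a} {b} a∈ b∈ νa≡νb with ∈-↑ a a∈ | ∈-↑ b b∈
... | a , a∈ , refl | b , b∈ , refl rewrite liftⁿ-wk ν a | liftⁿ-wk ν b = cong wk (ν-inj a∈ b∈ (wk-injective νa≡νb))

liftⁿ-injectiveOn-zero : ∀ {ν : Name m → Name n} → InjectiveOn Σ ν → InjectiveOn ((↑ Σ) ∪ ｛ var zero ｝) (liftⁿ ν)
liftⁿ-injectiveOn-zero ν-inj (inj₁ a∈) (inj₁ b∈) νa≡νb = liftⁿ-injectiveOn ν-inj a∈ b∈ νa≡νb
liftⁿ-injectiveOn-zero ν-inj (inj₂ refl) (inj₂ refl) _ = refl
liftⁿ-injectiveOn-zero {ν = ν} ν-inj {a} (inj₁ a∈) (inj₂ refl) νa≡νb with ∈-↑ a a∈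
... | a , _ , refl = contradiction (trans (sym (liftⁿ-wk ν a)) νa≡νb) (wk≢zero _)
liftⁿ-injectiveOn-zero {ν = ν} ν-inj {b = b} (inj₂ refl) (inj₁ b∈) νa≡νb with ∈-↑ b b∈
... | b , _ , refl = contradiction (trans (sym (liftⁿ-wk ν b)) (sym νa≡νb)) (wk≢zero _)

weaken-typed : Γ ⊢ e ∶ T → U ∷ Γ ⊢ weaken e ∶ T
weaken-typed (var x)   = var (suc x)
weaken-typed (val v)   = val v
weaken-typed (¬ₑ e)    = ¬ₑ weaken-typed e
weaken-typed (e ∨ₑ f)  = weaken-typed e ∨ₑ weaken-typed f
weaken-typed (e ≤ₑ f)  = weaken-typed e ≤ₑ weaken-typed f

-- ν is the action of σ on names.
record _∣_∶_⇒_ (σ : Fin m → Expr n) (ν : Name m → Name n) (Γ : Ctx m) (Ξ : Ctx n) : Set where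
  field
    typed : ∀ x → Ξ ⊢ σ x ∶ lookup Γ x
    acts  : ∀ a → Γ ⊢ ⌜ a ⌝ ∶ qubit → substₑ σ ⌜ a ⌝ ≡ ⌜ ν a ⌝
open _∣_∶_⇒_

module _ {σ : Fin m → Expr n} {ν : Name m → Name n} where

  lift-typed : σ ∣ ν ∶ Γ ⇒ Ξ → lift σ ∣ liftⁿ ν ∶ T ∷ Γ ⇒ (T ∷ Ξ)
  lift-typed σ∶ .typed zero    = var zero
  lift-typed σ∶ .typed (suc x) = weaken-typed (typed σ∶ x)
  lift-typed σ∶ .acts (qubit q) _ =
    trans (cong weaken (acts σ∶ (qubit q) (val _))) (sym (⌜wk⌝ (ν (qubit q))))
  lift-typed σ∶ .acts (var zero) _ = refl
  lift-typed σ∶ .acts (var (suc x)) t =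
    trans (cong weaken (acts σ∶ (var x) (var-typed (var-type t)))) (sym (⌜wk⌝ (ν (var x))))

  substₑ-typed : σ ∣ ν ∶ Γ ⇒ Ξ → Γ ⊢ e ∶ T → Ξ ⊢ substₑ σ e ∶ T
  substₑ-typed σ∶ (var x)   = typed σ∶ x
  substₑ-typed σ∶ (val v)   = val v
  substₑ-typed σ∶ (¬ₑ e)    = ¬ₑ substₑ-typed σ∶ e
  substₑ-typed σ∶ (e ∨ₑ f)  = substₑ-typed σ∶ e ∨ₑ substₑ-typed σ∶ f
  substₑ-typed σ∶ (e ≤ₑ f)  = substₑ-typed σ∶ e ≤ₑ substₑ-typed σ∶ f

  name-typed : σ ∣ ν ∶ Γ ⇒ Ξ → ∀ {a} → Γ ⊢ ⌜ a ⌝ ∶ qubit → Ξ ⊢ ⌜ ν a ⌝ ∶ qubit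
  name-typed σ∶ a∶ = subst (_ ⊢_∶ qubit) (acts σ∶ _ a∶) (substₑ-typed σ∶ a∶)

  names-act : σ ∣ ν ∶ Γ ⇒ Ξ → ∀ {as} → All (λ a → Γ ⊢ ⌜ a ⌝ ∶ qubit) as →
              List.map (substₑ σ) (List.map ⌜_⌝ as) ≡ List.map ⌜_⌝ (List.map ν as)
  names-act σ∶ []         = refl
  names-act σ∶ (a∶ ∷ as∶) = cong₂ _∷_ (acts σ∶ _ a∶) (names-act σ∶ as∶)

  names-actᵥ : σ ∣ ν ∶ Γ ⇒ Ξ → ∀ {k} {as : Vec (Name m) k} → Allᵥ (λ a → Γ ⊢ ⌜ a ⌝ ∶ qubit) as →
               Vec.map (substₑ σ) (Vec.map ⌜_⌝ as) ≡ Vec.map ⌜_⌝ (Vec.map ν as)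
  names-actᵥ σ∶ []         = refl
  names-actᵥ σ∶ (a∶ ∷ as∶) = cong₂ _∷_ (acts σ∶ _ a∶) (names-actᵥ σ∶ as∶)

-- Injectivity prevents the substitution from duplicating a qubit: distinct arguments stay distinct
-- and the two sides of a parallel composition stay disjoint. An arbitrary σ is treated, since a
-- substitution for one variable becomes a lifted one under a binder.
substₚ-typed : ∀ {σ : Fin m → Expr n} {ν} → σ ∣ ν ∶ Γ ⇒ Ξ → InjectiveOn Σ ν →
               Γ ⨾ Σ ⊢ P → Ξ ⨾ Image ν Σ ⊢ substₚ σ P
substₚ-typed {ν = ν} σ∶ ν-inj (discard as as∶ as! (Σ⊆as , as⊆Σ) refl) =
  discard (List.map ν as) (Allₚ.map⁺ (All.map (name-typed σ∶) as∶)) (unique-map ν-inj (All.tabulate as⊆Σ) as!)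
    ((λ { (a , a∈ , refl) → ∈-map⁺ ν (Σ⊆as a∈) }) ,
     (λ b∈ → let a , a∈ , b≡ = ∈-map⁻ ν b∈ in a , as⊆Σ a∈ , sym b≡))
    (names-act σ∶ as∶)
substₚ-typed σ∶ ν-inj (τ∙ P) = τ∙ substₚ-typed σ∶ ν-inj P
substₚ-typed {ν = ν} σ∶ ν-inj (apply as as! as∈ refl P) =
  apply (Vec.map ν as) (unique-mapᵥ ν-inj as∈ as!) (VecAllₚ.map⁺ (VecAll.map (λ a∈ → _ , a∈ , refl) as∈))
    (names-actᵥ σ∶ (VecAll.map (∈⇒qubit P) as∈)) (substₚ-typed σ∶ ν-inj P)
substₚ-typed {ν = ν} σ∶ ν-inj d@(measure as as! as∈ refl P) =
  measure (Vec.map ν as) (unique-mapᵥ ν-inj as∈ as!) (VecAllₚ.map⁺ (VecAll.map (λ a∈ → _ , a∈ , refl) as∈))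
    (names-actᵥ σ∶ (VecAll.map (∈⇒qubit d) as∈))
    (⊢-resp-≐ Image-↑ (substₚ-typed (lift-typed σ∶) (liftⁿ-injectiveOn ν-inj) P))
substₚ-typed σ∶ ν-inj (recvᶜ c≢ P) =
  recvᶜ c≢ (⊢-resp-≐ Image-↑ (substₚ-typed (lift-typed σ∶) (liftⁿ-injectiveOn ν-inj) P))
substₚ-typed σ∶ ν-inj (recvᵠ c≡ P) =
  recvᵠ c≡ (⊢-resp-≐ (≐-trans Image-∪ (∪-cong Image-↑ Image-｛｝))
    (substₚ-typed (lift-typed σ∶) (liftⁿ-injectiveOn-zero ν-inj) P))
substₚ-typed σ∶ ν-inj (sendᶜ c≢ e (Σ⊆∅ , _)) =
  sendᶜ c≢ (substₑ-typed σ∶ e) ((λ (_ , a∈ , _) → Σ⊆∅ a∈) , λ ())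
substₚ-typed {ν = ν} σ∶ ν-inj (sendᵠ a c≡ a∶ Σ≐a refl) =
  sendᵠ (ν a) c≡ (name-typed σ∶ a∶) (≐-trans (Image-cong Σ≐a) Image-｛｝) (acts σ∶ a a∶)
substₚ-typed σ∶ ν-inj (P ⊕ Q) = substₚ-typed σ∶ ν-inj P ⊕ substₚ-typed σ∶ ν-inj Q
substₚ-typed {ν = ν} σ∶ ν-inj (par Σ₁ Σ₂ Σ₁⊥Σ₂ Σ≐∪ P Q) =
  par (Image ν Σ₁) (Image ν Σ₂)
    -- A name in both images has a preimage on each side; injectivity on the union identifies the
    -- two, against disjointness.
    (λ { ((a , a∈ , refl) , (b , b∈ , νb≡νa)) →
         Σ₁⊥Σ₂ (a∈ , subst Σ₂ (ν-inj (proj₂ Σ≐∪ (inj₂ b∈)) (proj₂ Σ≐∪ (inj₁ a∈)) νb≡νa) b∈) })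
    (≐-trans (Image-cong Σ≐∪) Image-∪)
    (substₚ-typed σ∶ (λ a∈ b∈ → ν-inj (proj₂ Σ≐∪ (inj₁ a∈)) (proj₂ Σ≐∪ (inj₁ b∈))) P)
    (substₚ-typed σ∶ (λ a∈ b∈ → ν-inj (proj₂ Σ≐∪ (inj₂ a∈)) (proj₂ Σ≐∪ (inj₂ b∈))) Q)
substₚ-typed σ∶ ν-inj (res P) = res (substₚ-typed σ∶ ν-inj P)
substₚ-typed σ∶ ν-inj (ite e P Q) = ite (substₑ-typed σ∶ e) (substₚ-typed σ∶ ν-inj P) (substₚ-typed σ∶ ν-inj Q)

module _ (T : Ty) (i j : ℕ) where
  open Swap T i j

  -- Typing sees a channel only through `carries`, which `swapᶜ` leaves unchanged by definition, so
  -- every rule is reapplied with the same premises.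
  swap-typed⁺ : Γ ⨾ Σ ⊢ P → Γ ⨾ Σ ⊢ swap P
  swap-typed⁺ (discard as as∶ as! Σ≐as es≡) = discard as as∶ as! Σ≐as es≡
  swap-typed⁺ (τ∙ P)                        = τ∙ swap-typed⁺ P
  swap-typed⁺ (apply as as! as∈ es≡ P)      = apply as as! as∈ es≡ (swap-typed⁺ P)
  swap-typed⁺ (measure as as! as∈ es≡ P)    = measure as as! as∈ es≡ (swap-typed⁺ P)
  swap-typed⁺ (recvᶜ c≢ P)                  = recvᶜ c≢ (swap-typed⁺ P)
  swap-typed⁺ (recvᵠ c≡ P)                  = recvᵠ c≡ (swap-typed⁺ P)
  swap-typed⁺ (sendᶜ c≢ e Σ≐∅)              = sendᶜ c≢ e Σ≐∅
  swap-typed⁺ (sendᵠ a c≡ a∶ Σ≐a e≡)        = sendᵠ a c≡ a∶ Σ≐a e≡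
  swap-typed⁺ (P ⊕ Q)                       = swap-typed⁺ P ⊕ swap-typed⁺ Q
  swap-typed⁺ (par Σ₁ Σ₂ Σ₁⊥Σ₂ Σ≐∪ P Q)     = par Σ₁ Σ₂ Σ₁⊥Σ₂ Σ≐∪ (swap-typed⁺ P) (swap-typed⁺ Q)
  swap-typed⁺ (res P)                       = res (swap-typed⁺ P)
  swap-typed⁺ (ite e P Q)                   = ite e (swap-typed⁺ P) (swap-typed⁺ Q)

  -- `P` is explicit because `swap P` reveals its head, and thereby the last rule of the derivation,
  -- only after a match on `P`.
  swap-typed⁻ : ∀ (P : Proc n) → Γ ⨾ Σ ⊢ swap P → Γ ⨾ Σ ⊢ P
  swap-typed⁻ (discard _)     (discard as as∶ as! Σ≐as es≡) = discard as as∶ as! Σ≐as es≡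
  swap-typed⁻ (τ∙ P)          (τ∙ d)                        = τ∙ swap-typed⁻ P d
  swap-typed⁻ (apply _ _ P)   (apply as as! as∈ es≡ d)      = apply as as! as∈ es≡ (swap-typed⁻ P d)
  swap-typed⁻ (measure _ _ P) (measure as as! as∈ es≡ d)    = measure as as! as∈ es≡ (swap-typed⁻ P d)
  swap-typed⁻ (_ ？ P)        (recvᶜ c≢ d)                  = recvᶜ c≢ (swap-typed⁻ P d)
  swap-typed⁻ (_ ？ P)        (recvᵠ c≡ d)                  = recvᵠ c≡ (swap-typed⁻ P d)
  swap-typed⁻ (_ ！ _)        (sendᶜ c≢ e Σ≐∅)              = sendᶜ c≢ e Σ≐∅
  swap-typed⁻ (_ ！ _)        (sendᵠ a c≡ a∶ Σ≐a e≡)        = sendᵠ a c≡ a∶ Σ≐a e≡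
  swap-typed⁻ (P ⊕ Q)         (d ⊕ d′)                      = swap-typed⁻ P d ⊕ swap-typed⁻ Q d′
  swap-typed⁻ (P ∥ Q)         (par Σ₁ Σ₂ Σ₁⊥Σ₂ Σ≐∪ d d′)    = par Σ₁ Σ₂ Σ₁⊥Σ₂ Σ≐∪ (swap-typed⁻ P d) (swap-typed⁻ Q d′)
  swap-typed⁻ (P ╲ _)         (res d)                       = res (swap-typed⁻ P d)
  swap-typed⁻ (ite _ P Q)     (ite e d d′)                  = ite e (swap-typed⁻ P d) (swap-typed⁻ Q d′)

-- Junk on the values other than qubits, which have no name.
nameOf : Value → Name n
nameOf (qubit q) = qubit q
nameOf _         = qubit 0

instantiate : Value → Name (ℕ.suc n) → Name n
instantiate v (qubit q)     = qubit q
instantiate v (var zero)    = nameOf v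
instantiate v (var (suc x)) = var x

instantiate-wk : ∀ v (a : Name n) → instantiate v (wk a) ≡ a
instantiate-wk v (qubit _) = refl
instantiate-wk v (var _)   = refl

-- `instantiate v` undoes `wk`, so names from outside the binder are unaffected by the value
-- received or measured.
Image-instantiate-↑ : ∀ v → Image (instantiate v) (↑ Σ) ≐ Σ
Image-instantiate-↑ {Σ = Σ} v = to , λ {a} a∈ → wk a , wk-∈⁺ a a∈ , instantiate-wk v a
  where
  to : Image (instantiate v) (↑ Σ) ⊆ Σ
  to (b , b∈ , refl) with ∈-↑ b b∈
  ... | a , a∈ , refl = subst Σ (sym (instantiate-wk v a)) a∈

instantiate-injectiveOn-↑ : ∀ v → InjectiveOn (↑ Σ) (instantiate v)
instantiate-injectiveOn-↑ v {a} {b} a∈ b∈ va≡vb with ∈-↑ a a∈ | ∈-↑ b b∈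
... | a , _ , refl | b , _ , refl = cong wk (trans (sym (instantiate-wk v a)) (trans va≡vb (instantiate-wk v b)))

instantiate-injectiveOn-zero : ∀ {q} → ¬ Σ (qubit q) → InjectiveOn ((↑ Σ) ∪ ｛ var zero ｝) (instantiate (qubit q))
instantiate-injectiveOn-zero q∉ (inj₁ a∈) (inj₁ b∈) va≡vb = instantiate-injectiveOn-↑ _ a∈ b∈ va≡vb
instantiate-injectiveOn-zero q∉ (inj₂ refl) (inj₂ refl) _ = refl
instantiate-injectiveOn-zero {Σ = Σ} q∉ {a} (inj₁ a∈) (inj₂ refl) va≡q with ∈-↑ a a∈
... | a , a∈ , refl = contradiction (subst Σ (trans (sym (instantiate-wk _ a)) va≡q) a∈) q∉
instantiate-injectiveOn-zero {Σ = Σ} q∉ {b = b} (inj₂ refl) (inj₁ b∈) q≡vb with ∈-↑ b b∈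
... | b , b∈ , refl = contradiction (subst Σ (trans (sym (instantiate-wk _ b)) (sym q≡vb)) b∈) q∉

[]-typed : ∀ v → InjectiveOn Σ (instantiate v) → typeOf v ∷ Γ ⨾ Σ ⊢ P → Γ ⨾ Image (instantiate v) Σ ⊢ P [ v ]
[]-typed {Γ = Γ} v ν-inj d = substₚ-typed
  (record { typed = λ { zero → val v ; (suc x) → var x }
          ; acts = λ { (qubit _) _ → refl ; (var zero) t → zero-acts v (var-type t) ; (var (suc x)) _ → refl } })
  ν-inj d
  where
  -- The default in `nameOf` never matters: `acts` is demanded only at type `qubit`, which leaves no
  -- other kind of value.
  zero-acts : ∀ v → typeOf v ≡ qubit → val v ≡ ⌜ nameOf v ⌝
  zero-acts (qubit q) _ = refl

-- Evaluation and structural congruence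

eval-preserves : e ⇓ v → Γ ⊢ e ∶ T → Γ ⊢ val v ∶ T
eval-preserves (val v)    t         = t
eval-preserves (¬ₑ _)     (¬ₑ _)    = val _
eval-preserves (_ ∨ₑ _)   (_ ∨ₑ _)  = val _
eval-preserves (_ ≤ₑ _)   (_ ≤ₑ _)  = val _

-- Evaluation has no rule for variables and fixes the kind of every operand, so an expression with a
-- value is typable in any context. This types the guard when a conditional is reintroduced from one
-- of its branches.
eval-reflects : e ⇓ v → Γ ⊢ val v ∶ T → Γ ⊢ e ∶ T
eval-reflects (val v)   t       = t
eval-reflects (¬ₑ e)    (val _) = ¬ₑ eval-reflects e (val _)
eval-reflects (e ∨ₑ f)  (val _) = eval-reflects e (val _) ∨ₑ eval-reflects f (val _)
eval-reflects (e ≤ₑ f)  (val _) = eval-reflects e (val _) ≤ₑ eval-reflects f (val _)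

name-eval : ∀ (a : Name n) → ⌜ a ⌝ ⇓ v → val v ≡ ⌜ a ⌝
name-eval (qubit q) (val _) = refl

-- All operators return booleans, so only a literal qubit evaluates to a qubit; `sendᵠ`, which
-- demands a literal name, is thus stable under `send-eval` in reverse.
eval-name : ∀ (a : Name n) → e ⇓ v → val v ≡ ⌜ a ⌝ → e ≡ ⌜ a ⌝
eval-name (qubit q) (val _) refl = refl

infix 3 _⊢_⇄_

-- Both directions are carried together because `≋-sym` exchanges them, and Σ is quantified inside
-- because `∥-cong` uses the statement at the sets of the two components.
_⊢_⇄_ : Ctx n → Proc n → Proc n → Set₁
Γ ⊢ P ⇄ Q = ∀ {Σ} → (Γ ⨾ Σ ⊢ P → Γ ⨾ Σ ⊢ Q) × (Γ ⨾ Σ ⊢ Q → Γ ⨾ Σ ⊢ P)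

par-comm : Γ ⨾ Σ ⊢ P ∥ Q → Γ ⨾ Σ ⊢ Q ∥ P
par-comm (par Σ₁ Σ₂ Σ₁⊥Σ₂ (Σ⊆ , ⊆Σ) P Q) =
  par Σ₂ Σ₁ (λ (b , a) → Σ₁⊥Σ₂ (a , b)) (Sum.swap ∘ Σ⊆ , ⊆Σ ∘ Sum.swap) Q P

par-assoc⁺ : ∀ {R} → Γ ⨾ Σ ⊢ (P ∥ Q) ∥ R → Γ ⨾ Σ ⊢ P ∥ (Q ∥ R)
par-assoc⁺ (par Σ₁₂ Σ₃ Σ₁₂⊥Σ₃ (Σ⊆ , ⊆Σ) (par Σ₁ Σ₂ Σ₁⊥Σ₂ (Σ₁₂⊆ , ⊆Σ₁₂) P Q) R) =
  par Σ₁ (Σ₂ ∪ Σ₃)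
    (λ { (a , inj₁ b) → Σ₁⊥Σ₂ (a , b) ; (a , inj₂ c) → Σ₁₂⊥Σ₃ (⊆Σ₁₂ (inj₁ a) , c) })
    (Sum.assocʳ ∘ Sum.map₁ Σ₁₂⊆ ∘ Σ⊆ , ⊆Σ ∘ Sum.map₁ ⊆Σ₁₂ ∘ Sum.assocˡ)
    P (par Σ₂ Σ₃ (λ (b , c) → Σ₁₂⊥Σ₃ (⊆Σ₁₂ (inj₂ b) , c)) ≐-refl Q R)

par-assoc⁻ : ∀ {R} → Γ ⨾ Σ ⊢ P ∥ (Q ∥ R) → Γ ⨾ Σ ⊢ (P ∥ Q) ∥ R
par-assoc⁻ (par Σ₁ Σ₂₃ Σ₁⊥Σ₂₃ (Σ⊆ , ⊆Σ) P (par Σ₂ Σ₃ Σ₂⊥Σ₃ (Σ₂₃⊆ , ⊆Σ₂₃) Q R)) =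
  par (Σ₁ ∪ Σ₂) Σ₃
    (λ { (inj₁ a , c) → Σ₁⊥Σ₂₃ (a , ⊆Σ₂₃ (inj₂ c)) ; (inj₂ b , c) → Σ₂⊥Σ₃ (b , c) })
    (Sum.assocˡ ∘ Sum.map₂ Σ₂₃⊆ ∘ Σ⊆ , ⊆Σ ∘ Sum.map₂ ⊆Σ₂₃ ∘ Sum.assocʳ)
    (par Σ₁ Σ₂ (λ (a , b) → Σ₁⊥Σ₂₃ (a , ⊆Σ₂₃ (inj₁ b))) ≐-refl P Q) R

discard[]-∅ : Γ ⨾ Σ ⊢ discard [] → Σ ⊆ ∅
discard[]-∅ (discard [] _ _ (Σ⊆ , _) _) a∈ with () ← Σ⊆ a∈

par-nil : Γ ⨾ Σ ⊢ P ∥ discard [] → Γ ⨾ Σ ⊢ P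
par-nil (par Σ₁ Σ₂ _ (Σ⊆ , ⊆Σ) P 𝟎) =
  ⊢-resp-≐ (⊆Σ ∘ inj₁ , Sum.[ id , ⊥-elim ∘ discard[]-∅ 𝟎 ] ∘ Σ⊆) P

send-eval-typed : ∀ {c} → e ⇓ v → Γ ⊢ c ！ e ⇄ c ！ val v
send-eval-typed e⇓v .proj₁ (sendᶜ c≢ e Σ≐∅)          = sendᶜ c≢ (eval-preserves e⇓v e) Σ≐∅
send-eval-typed e⇓v .proj₁ (sendᵠ a c≡ a∶ Σ≐a refl)  = sendᵠ a c≡ a∶ Σ≐a (name-eval a e⇓v)
send-eval-typed e⇓v .proj₂ (sendᶜ c≢ v Σ≐∅)          = sendᶜ c≢ (eval-reflects e⇓v v) Σ≐∅
send-eval-typed e⇓v .proj₂ (sendᵠ a c≡ a∶ Σ≐a v≡)    = sendᵠ a c≡ a∶ Σ≐a (eval-name a e⇓v v≡)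

≋-typed : Γ ⊢ P ≋ Q → Γ ⊢ P ⇄ Q
≋-typed ≋-refl = id , id
≋-typed (≋-sym P≋Q) = Product.swap (≋-typed P≋Q)
≋-typed (≋-trans P≋Q Q≋R) =
  proj₁ (≋-typed Q≋R) ∘ proj₁ (≋-typed P≋Q) , proj₂ (≋-typed P≋Q) ∘ proj₂ (≋-typed Q≋R)
≋-typed (τ-cong P≋Q) =
  (λ { (τ∙ P) → τ∙ proj₁ (≋-typed P≋Q) P }) , (λ { (τ∙ Q) → τ∙ proj₂ (≋-typed P≋Q) Q })
≋-typed (apply-cong P≋Q) =
  (λ { (apply as as! as∈ es≡ P) → apply as as! as∈ es≡ (proj₁ (≋-typed P≋Q) P) }) ,
  (λ { (apply as as! as∈ es≡ Q) → apply as as! as∈ es≡ (proj₂ (≋-typed P≋Q) Q) })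
≋-typed (measure-cong P≋Q) =
  (λ { (measure as as! as∈ es≡ P) → measure as as! as∈ es≡ (proj₁ (≋-typed P≋Q) P) }) ,
  (λ { (measure as as! as∈ es≡ Q) → measure as as! as∈ es≡ (proj₂ (≋-typed P≋Q) Q) })
-- Exposing the carried type as a variable lets `refl` set it to `qubit`, after which the contexts
-- of `recvᵠ` and of the congruence coincide.
≋-typed (recv-cong {c = chan _ _} P≋Q) =
  (λ { (recvᶜ c≢ P) → recvᶜ c≢ (proj₁ (≋-typed P≋Q) P) ; (recvᵠ refl P) → recvᵠ refl (proj₁ (≋-typed P≋Q) P) }) ,
  (λ { (recvᶜ c≢ Q) → recvᶜ c≢ (proj₂ (≋-typed P≋Q) Q) ; (recvᵠ refl Q) → recvᵠ refl (proj₂ (≋-typed P≋Q) Q) })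
≋-typed (⊕-cong P≋P′ Q≋Q′) =
  (λ { (P ⊕ Q) → proj₁ (≋-typed P≋P′) P ⊕ proj₁ (≋-typed Q≋Q′) Q }) ,
  (λ { (P ⊕ Q) → proj₂ (≋-typed P≋P′) P ⊕ proj₂ (≋-typed Q≋Q′) Q })
≋-typed (∥-cong P≋P′ Q≋Q′) =
  (λ { (par Σ₁ Σ₂ Σ₁⊥Σ₂ Σ≐∪ P Q) → par Σ₁ Σ₂ Σ₁⊥Σ₂ Σ≐∪ (proj₁ (≋-typed P≋P′) P) (proj₁ (≋-typed Q≋Q′) Q) }) ,
  (λ { (par Σ₁ Σ₂ Σ₁⊥Σ₂ Σ≐∪ P Q) → par Σ₁ Σ₂ Σ₁⊥Σ₂ Σ≐∪ (proj₂ (≋-typed P≋P′) P) (proj₂ (≋-typed Q≋Q′) Q) })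
≋-typed (╲-cong P≋Q) =
  (λ { (res P) → res (proj₁ (≋-typed P≋Q) P) }) , (λ { (res Q) → res (proj₂ (≋-typed P≋Q) Q) })
≋-typed (ite-cong P≋P′ Q≋Q′) =
  (λ { (ite e P Q) → ite e (proj₁ (≋-typed P≋P′) P) (proj₁ (≋-typed Q≋Q′) Q) }) ,
  (λ { (ite e P Q) → ite e (proj₂ (≋-typed P≋P′) P) (proj₂ (≋-typed Q≋Q′) Q) })
≋-typed ⊕-comm = (λ { (P ⊕ Q) → Q ⊕ P }) , (λ { (Q ⊕ P) → P ⊕ Q })
≋-typed ⊕-assoc = (λ { ((P ⊕ Q) ⊕ R) → P ⊕ (Q ⊕ R) }) , (λ { (P ⊕ (Q ⊕ R)) → (P ⊕ Q) ⊕ R })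
-- The set in the axiom's premises and the set of the given derivation both type `P`; uniqueness
-- identifies them, which carries the typing of the reintroduced summand over. The two axioms for
-- conditionals work alike.
≋-typed (⊕-nil P′ 𝟎) = (λ { (P ⊕ _) → P }) , (λ P → P ⊕ ⊢-resp-≐ (⊢-unique P′ P) 𝟎)
≋-typed ∥-comm = par-comm , par-comm
≋-typed ∥-assoc = par-assoc⁺ , par-assoc⁻
≋-typed ∥-nil =
  par-nil ,
  (λ P → par _ ∅ (λ ()) (inj₁ , λ { (inj₁ a∈) → a∈ }) P (discard [] [] [] ((λ ()) , λ ()) refl))
≋-typed ╲-comm = (λ { (res (res P)) → res (res P) }) , (λ { (res (res P)) → res (res P) })
≋-typed ╲-nil = (λ { (res P) → P }) , res
≋-typed (╲-extr _) =
  (λ { (par Σ₁ Σ₂ Σ₁⊥Σ₂ Σ≐∪ (res P) Q) → res (par Σ₁ Σ₂ Σ₁⊥Σ₂ Σ≐∪ P Q) }) ,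
  (λ { (res (par Σ₁ Σ₂ Σ₁⊥Σ₂ Σ≐∪ P Q)) → par Σ₁ Σ₂ Σ₁⊥Σ₂ Σ≐∪ (res P) Q })
≋-typed (╲-alpha {P} T i j _) =
  (λ { (res P) → res (swap-typed⁺ T i j P) }) , (λ { (res d) → res (swap-typed⁻ T i j P d) })
≋-typed (send-eval e⇓v) = send-eval-typed e⇓v
≋-typed (ite-true e⇓true P′ Q′) =
  (λ { (ite _ P _) → P }) ,
  (λ P → ite (eval-reflects e⇓true (val _)) P (⊢-resp-≐ (⊢-unique P′ P) Q′))
≋-typed (ite-false e⇓false P′ Q′) =
  (λ { (ite _ _ Q) → Q }) ,
  (λ Q → ite (eval-reflects e⇓false (val _)) (⊢-resp-≐ (⊢-unique Q′ Q) P′) Q)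

-- Reductions

private variable
  Θ Θ′ Θ″ : QubitSet
  ΘΘ : QubitSet × QubitSet
  C : Conf
  Δ Δ′ : Dist

unique-mapᵥ⁻ : ∀ {A B : Set} {f : A → B} {k} {as : Vec A k} → Uniqueᵥ (Vec.map f as) → Uniqueᵥ as
unique-mapᵥ⁻ {as = []}     []          = []
unique-mapᵥ⁻ {f = f} {as = _ ∷ _} (fa≢ ∷ as!) = VecAll.map (λ fa≢fb → fa≢fb ∘ cong f) (VecAllₚ.map⁻ fa≢) ∷ unique-mapᵥ⁻ as!

-- The linear typing makes the argument names distinct. Equal positions would hold equal qubits, so
-- distinctness is pulled back along the two maps from positions to expressions.
positions-unique : ∀ {k reg} (pos : Vec (Fin (List.length reg)) k) {qs : Vec Qubit k} (as : Vec (Name 0) k) →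
                   Vec.map (List.lookup reg) pos ≡ qs → Vec.map (λ q → val (qubit q)) qs ≡ Vec.map ⌜_⌝ as →
                   Uniqueᵥ as → Uniqueᵥ pos
positions-unique pos as refl qs≡as as! =
  unique-mapᵥ⁻ (unique-mapᵥ⁻ (subst Uniqueᵥ (sym qs≡as) (Uniqueᵥₚ.map⁺ ⌜⌝-injective as!)))

dirac-typed : ΘΘ ⊢ᶜ C → ΘΘ ⊢ᵈ dirac C
dirac-typed C = record
  { isDistribution = record { nonNegative = 0≤1 ∷ [] ; normalised = ≗⇒≈ λ _ → refl }
  ; support        = (λ _ → C) ∷ []
  }

module _ {f : Proc 0 → Proc 0} where

  mapProc-weights : ∀ Δ → List.map proj₁ (mapProc f Δ) ≡ List.map proj₁ Δ
  mapProc-weights Δ = sym (Listₚ.map-∘ Δ)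

  mapProc-nonNegative : ∀ Δ → All (λ (p , _) → 0ᵣ ≤ᵣ p) Δ → All (λ (p , _) → 0ᵣ ≤ᵣ p) (mapProc f Δ)
  mapProc-nonNegative Δ = Allₚ.map⁺

  mapProc-support : (∀ {ρ P} → (Θ , Θ′) ⊢ᶜ ⟪ ρ , P ⟫ → (Θ , Θ″) ⊢ᶜ ⟪ ρ , f P ⟫) →
                    ∀ Δ → All (λ (p , C) → ¬ p ≈ᵣ 0ᵣ → (Θ , Θ′) ⊢ᶜ C) Δ →
                    All (λ (p , C) → ¬ p ≈ᵣ 0ᵣ → (Θ , Θ″) ⊢ᶜ C) (mapProc f Δ)
  mapProc-support f-typed []                    []       = []
  mapProc-support f-typed ((p , ⊥ᶜ) ∷ Δ)        (_ ∷ Cs) = (λ _ → dead) ∷ mapProc-support f-typed Δ Cs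
  mapProc-support f-typed ((p , ⟪ ρ , P ⟫) ∷ Δ) (C ∷ Cs) = f-typed ∘ C ∷ mapProc-support f-typed Δ Cs

  -- The sets Θ′ and Θ″ may differ for the sake of `par`, where `Δ` is typed by the share of the
  -- component that moves.
  mapProc-typed : (∀ {ρ P} → (Θ , Θ′) ⊢ᶜ ⟪ ρ , P ⟫ → (Θ , Θ″) ⊢ᶜ ⟪ ρ , f P ⟫) →
                  (Θ , Θ′) ⊢ᵈ Δ → (Θ , Θ″) ⊢ᵈ mapProc f Δ
  mapProc-typed {Δ = Δ} f-typed Δ-typed = record
    { isDistribution = record
      { nonNegative = mapProc-nonNegative Δ nonNegative
      ; normalised  = subst (λ ps → List.foldr _+ᵣ_ 0ᵣ ps ≈ᵣ 1ᵣ) (sym (mapProc-weights Δ)) normalised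
      }
    ; support = mapProc-support f-typed Δ support
    }
    where
    open _⊢ᵈ_ Δ-typed
    open IsDistribution isDistribution

≋ᶜ-typed : ∀ {D} → C ≋ᶜ D → ΘΘ ⊢ᶜ C → ΘΘ ⊢ᶜ D
≋ᶜ-typed dead              dead                     = dead
≋ᶜ-typed (conf (eq A≈B) P≋Q) (conf reg! Θ≐ ρ P Θ′⊆Θ) =
  conf reg! Θ≐ (isDensity-resp-≈ₒ A≈B ρ) (proj₁ (≋-typed P≋Q) P) Θ′⊆Θ

≋ᵈ-nonNegative : Δ ≋ᵈ Δ′ → All (λ (p , _) → 0ᵣ ≤ᵣ p) Δ → All (λ (p , _) → 0ᵣ ≤ᵣ p) Δ′
≋ᵈ-nonNegative []                []         = []
≋ᵈ-nonNegative ((p≈q , _) ∷ Δ≋Δ′) (0≤p ∷ 0≤) = 0≤-resp-≈ p≈q 0≤p ∷ ≋ᵈ-nonNegative Δ≋Δ′ 0≤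

≋ᵈ-weights : Δ ≋ᵈ Δ′ → List.foldr _+ᵣ_ 0ᵣ (List.map proj₁ Δ) ≈ᵣ List.foldr _+ᵣ_ 0ᵣ (List.map proj₁ Δ′)
≋ᵈ-weights []                 = ≈-refl
≋ᵈ-weights ((p≈q , _) ∷ Δ≋Δ′) = +-cong p≈q (≋ᵈ-weights Δ≋Δ′)

≋ᵈ-support : Δ ≋ᵈ Δ′ → All (λ (p , C) → ¬ p ≈ᵣ 0ᵣ → ΘΘ ⊢ᶜ C) Δ → All (λ (p , C) → ¬ p ≈ᵣ 0ᵣ → ΘΘ ⊢ᶜ C) Δ′
≋ᵈ-support []                   []       = []
≋ᵈ-support ((p≈q , C≋D) ∷ Δ≋Δ′) (C ∷ Cs) =
  (λ q≉0 → ≋ᶜ-typed C≋D (C λ p≈0 → q≉0 (≈-trans (≈-sym p≈q) p≈0))) ∷ ≋ᵈ-support Δ≋Δ′ Cs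

≋ᵈ-typed : Δ ≋ᵈ Δ′ → ΘΘ ⊢ᵈ Δ → ΘΘ ⊢ᵈ Δ′
≋ᵈ-typed Δ≋Δ′ Δ-typed = record
  { isDistribution = record
    { nonNegative = ≋ᵈ-nonNegative Δ≋Δ′ nonNegative
    ; normalised  = ≈-trans (≈-sym (≋ᵈ-weights Δ≋Δ′)) normalised
    }
  ; support = ≋ᵈ-support Δ≋Δ′ support
  }
  where
  open _⊢ᵈ_ Δ-typed
  open IsDistribution isDistribution

-- Without free variables every name is a qubit. This turns the share of a parallel component into a
-- `QubitSet`, as typing of configurations requires.
names-qubit : ∀ (A : NameSet 0) → names (A ∘ qubit) ≐ A
names-qubit A = to , from
  where
  to : names (A ∘ qubit) ⊆ A
  to {qubit _} = id
  from : A ⊆ names (A ∘ qubit)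
  from {qubit _} = id

comm-typed : ∀ {A : NameSet 0} {c v P Q R} →
             [] ⨾ A ⊢ (c ！ val v ⊕ R) ∥ (c ？ P ⊕ Q) → [] ⨾ A ⊢ P [ v ]
-- A classical sender owns nothing, so the receiver already owns all of `A`.
comm-typed {A} {v = v} {P} (par A₁ A₂ _ (A⊆ , ⊆A) (sendᶜ _ v∶ (A₁⊆∅ , _) ⊕ _) (recvᶜ _ P∶ ⊕ _)) =
  ⊢-resp-≐ (≐-trans (Image-instantiate-↑ v) (⊆A ∘ inj₂ , Sum.[ ⊥-elim ∘ A₁⊆∅ , id ] ∘ A⊆))
    ([]-typed v (instantiate-injectiveOn-↑ v) (subst (λ T → T ∷ [] ⨾ ↑ A₂ ⊢ P) (sym (val-type v∶)) P∶))
-- The sender owns exactly q, which passes to the receiver: the union of `A₂` and q is again `A`,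
-- and disjointness makes q fresh for `A₂`.
comm-typed (par A₁ A₂ A₁⊥A₂ A≐∪ (sendᵠ (qubit q) _ _ A₁≐q refl ⊕ _) (recvᵠ _ P∶ ⊕ _)) =
  ⊢-resp-≐
    (≐-trans Image-∪ (≐-trans (∪-cong (Image-instantiate-↑ (qubit q)) (≐-trans Image-｛｝ (≐-sym A₁≐q)))
      (≐-trans (Sum.swap , Sum.swap) (≐-sym A≐∪))))
    ([]-typed (qubit q) (instantiate-injectiveOn-zero λ q∈A₂ → A₁⊥A₂ (proj₂ A₁≐q refl , q∈A₂)) P∶)
comm-typed (par _ _ _ _ (sendᶜ c≢ _ _ ⊕ _) (recvᵠ c≡ _ ⊕ _))     = contradiction c≡ c≢
comm-typed (par _ _ _ _ (sendᵠ _ c≡ _ _ _ ⊕ _) (recvᶜ c≢ _ ⊕ _)) = contradiction c≡ c≢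

measure-isDistribution :
  ∀ {k n} (M : Measurement k) (pos : Vec (Fin n) k) → Uniqueᵥ pos → ∀ {ρ} → IsDensity ρ → ∀ (C : Fin (size M) → Conf) →
  IsDistribution (List.tabulate λ m → re (tr (conjugate (kraus M m) pos ρ)) , C m)
measure-isDistribution M pos pos! {ρ} ρ-density C = record
  { nonNegative = Allₚ.tabulate⁺ λ m → NonNegReal.0≤re
      (tr-nonNegReal (conjugate-isPositive (kraus M m) pos (IsDensity.positive ρ-density)))
  ; normalised = subst (_≈ᵣ 1ᵣ)
      (trans (re-sum weight) (cong (List.foldr _+ᵣ_ 0ᵣ) (sym (Listₚ.map-tabulate (λ m → re (weight m) , C m) proj₁))))
      (re-cong (∑-tr-conjugate M pos pos! ρ-density))
  }
  where
  weight : Fin (size M) → ℂ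
  weight m = tr (conjugate (kraus M m) pos ρ)

-- Θ′ has to vary in the induction: under `par` the moving component is typed by its own share,
-- while Θ, which lists the register, stays fixed.
⟶₀-typed : (Θ , Θ′) ⊢ᶜ C → C ⟶₀ Δ → (Θ , Θ′) ⊢ᵈ Δ
⟶₀-typed (conf reg! Θ≐ ρ (τ∙ P ⊕ _) Θ′⊆Θ) tau = dirac-typed (conf reg! Θ≐ ρ P Θ′⊆Θ)
⟶₀-typed (conf reg! Θ≐ ρ (apply {ℰ = ℰ} as as! _ es≡ P ⊕ _) Θ′⊆Θ) (apply {reg = reg} pos pos≡) =
  dirac-typed (conf reg! Θ≐ (applyAt-isDensity ℰ pos (positions-unique {reg = reg} pos as pos≡ es≡ as!) ρ) P Θ′⊆Θ)
⟶₀-typed (conf reg! Θ≐ ρ (measure {M = M} as as! _ es≡ P ⊕ _) Θ′⊆Θ) (measure {reg = reg} pos pos≡ σ pσ≈) = record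
  { isDistribution = measure-isDistribution M pos (positions-unique {reg = reg} pos as pos≡ es≡ as!) ρ _
  ; support = Allₚ.tabulate⁺ λ m p≉0 → conf reg! Θ≐
      (normalise-isDensity (conjugate-isPositive (kraus M m) pos (IsDensity.positive ρ)) p≉0 (pσ≈ m))
      (⊢-resp-≐ (Image-instantiate-↑ (nat (toℕ m))) ([]-typed (nat (toℕ m)) (instantiate-injectiveOn-↑ _) P))
      Θ′⊆Θ
  }
⟶₀-typed (conf reg! Θ≐ ρ P Θ′⊆Θ) comm = dirac-typed (conf reg! Θ≐ ρ (comm-typed P) Θ′⊆Θ)
⟶₀-typed {Θ = Θ} {Θ′} (conf reg! Θ≐ ρ (par Σ₁ Σ₂ Σ₁⊥Σ₂ Θ′≐∪ P Q) Θ′⊆Θ) (par {Q = Q′} P⟶Δ) =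
  mapProc-typed reassemble
    (⟶₀-typed (conf reg! Θ≐ ρ (⊢-resp-≐ (≐-sym (names-qubit Σ₁)) P) λ q∈Σ₁ → Θ′⊆Θ (proj₂ Θ′≐∪ (inj₁ q∈Σ₁))) P⟶Δ)
  where
  -- Every outcome is typed by the same share as before the step, so the idle component keeps its
  -- derivation and the disjointness proof is reused.
  reassemble : ∀ {ρ P} → (Θ , Σ₁ ∘ qubit) ⊢ᶜ ⟪ ρ , P ⟫ → (Θ , Θ′) ⊢ᶜ ⟪ ρ , P ∥ Q′ ⟫
  reassemble (conf reg! Θ≐ ρ P _) =
    conf reg! Θ≐ ρ (par Σ₁ Σ₂ Σ₁⊥Σ₂ Θ′≐∪ (⊢-resp-≐ (names-qubit Σ₁) P) Q) Θ′⊆Θ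
⟶₀-typed (conf reg! Θ≐ ρ (res P) Θ′⊆Θ) (res P⟶Δ) =
  mapProc-typed (λ { (conf reg! Θ≐ ρ P Θ′⊆Θ) → conf reg! Θ≐ ρ (res P) Θ′⊆Θ })
    (⟶₀-typed (conf reg! Θ≐ ρ P Θ′⊆Θ) P⟶Δ)
⟶₀-typed C-typed (congr C≋C′ C′⟶Δ′ Δ′≋Δ) = ≋ᵈ-typed Δ′≋Δ (⟶₀-typed (≋ᶜ-typed C≋C′ C-typed) C′⟶Δ′)

theorem3p4 : ∀ (Σρ Σₚ : QubitSet) (ρ : State) (P : Proc 0) (Δ : Dist) →
    (Σρ , Σₚ) ⊢ᶜ ⟪ ρ , P ⟫ →
    ⟪ ρ , P ⟫ ⟶ Δ →
    (Σρ , Σₚ) ⊢ᵈ Δ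
theorem3p4 _ _ _ _ _ C-typed (step C⟶₀Δ)  = ⟶₀-typed C-typed C⟶₀Δ
theorem3p4 _ _ _ _ _ _       (deadlock _) = dirac-typed dead
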